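{- For all integers $n\ge 4$, we have $\mathrm{ID}(n)\le\lfloor\frac n2\rfloor$. Moreover, $\mathrm{ID}(3)=1$, $\mathrm{ID}(4)=\mathrm{ID}(5)=2$, $\mathrm{ID}(6)=\mathrm{ID}(7)=\mathrm{ID}(8)=3$, and $\mathrm{ID}(n)\ge 3$ for all $n\ge 9$.
   Context: Let $X$ be a finite set with $|X|\ge 3$. A split of $X$ is an unordered bipartition $A|B=B|A$ of $X$ into two non-empty disjoint subsets (its parts) with $A\cup B=X$. It is trivial if one of its parts has size 1. A split system on $X$ is a set $\mathcal S$ of splits of $X$ that contains all trivial splits $\{x\}|X-\{x\}$, $x\in X$. For $S\in\mathcal S$ and $x\in X$, $S(x)$ denotes the part of $S$ containing $x$. The Buneman graph $\mathcal B(\mathcal S)$ has as vertices all maps $\phi:\mathcal S\to\mathcal P(X)$ such that (B1) $\phi(S)\in S$ for all $S\in\mathcal S$, and (B2) $\phi(S)\cap\phi(S')\ne\emptyset$ for all distinct $S,S'\in\mathcal S$. Two vertices $\phi,\phi'$ are adjacent if there is a unique $S\in\mathcal S$ with $\phi(S)\neq\phi'(S)$. For $x\in X$, $\phi_x$ denotes the vertex $S\mapsto S(x)$. It is known that $\mathcal B(\mathcal S)$ is a median graph, i.e. it is connected and any three vertices $u,v,w$ have a unique median (a vertex lying on shortest paths between each pair of $u,v,w$). For $Y=\{x,y,z\}\in\binom X3$, $\phi_Y$ denotes the median of $\phi_x,\phi_y,\phi_z$ in $\mathcal B(\mathcal S)$. The split system $\mathcal S$ is injective if $\phi_Y\ne\phi_{Y'}$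 for all distinct $Y,Y'\in\binom X3$. Two distinct splits $A|B$ and $C|D$ of $X$ are incompatible if $A\cap C$, $A\cap D$, $B\cap C$, $B\cap D$ are all non-empty. A set of splits is incompatible if any two distinct splits in it are incompatible. The dimension $\dim(\mathcal S)$ is the dimension of the largest hypercube contained in $\mathcal B(\mathcal S)$ (and 1 if $\mathcal B(\mathcal S)$ is a tree); equivalently (known), it is the maximum size of an incompatible subset of $\mathcal S$. For $n\ge 3$, the injective dimension is $\mathrm{ID}(n)=\min\{\dim(\mathcal S):\mathcal S\text{ is an injective split system on }\{1,\dots,n\}\}$. -}

module Defs where

open import Data.Bool using (Bool; if_then_else_)
open import Data.Fin using (Fin)
open import Data.Fin.Subset
open import Data.Fin.Subset.Properties using (_∈?_; x∉p⇒x∈∁p; x∈p∩q⁺)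
open import Data.Nat using (ℕ; zero; suc; _+_; _≤_)
open import Data.Product using (∃; ∃!; _×_; _,_)
open import Data.Sum using (_⊎_; inj₁; inj₂)
open import Data.Vec using (Vec; lookup)
open import Function.Bundles using (Injection)
open import Level using (0ℓ)
open import Relation.Binary.Bundles using (Setoid)
import Relation.Binary.Construct.On as On
open import Relation.Binary.Core using (Rel)
open import Relation.Binary.PropositionalEquality
  using (_≡_; _≢_; refl; setoid; _→-setoid_)
open import Relation.Nullary using (¬_; does; yes; no)

IsMinimum : (ℕ → Set) → ℕ → Set
IsMinimum P d = P d × (∀ e → P e → d ≤ e)

IsMaximum : (ℕ → Set) → ℕ → Set
IsMaximum P d = P d × (∀ e → P e → e ≤ d)

record Graph : Set₁ where
  field
    vertices : Setoid 0ℓ 0ℓ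
  open Setoid vertices public using (_≈_) renaming (Carrier to Vertex)
  infix 4 _~_
  field
    _~_ : Rel Vertex 0ℓ

module _ (G : Graph) where
  open Graph G

  data Walk : Vertex → Vertex → ℕ → Set where
    stop : ∀ {u v} → u ≈ v → Walk u v zero
    step : ∀ {u v w l} → u ~ v → Walk v w l → Walk u w (suc l)

  -- A walk from u to w through m, split at m, none being shorter.
  OnShortestPath : Vertex → Vertex → Vertex → Set
  OnShortestPath u w m = ∃ λ k → ∃ λ l →
    Walk u m k × Walk m w l × (∀ {j} → Walk u w j → k + l ≤ j)

  IsMedian : Vertex → Vertex → Vertex → Vertex → Set
  IsMedian u v w m =
    OnShortestPath u v m × OnShortestPath v w m × OnShortestPath u w m

-- As a not necessarily induced subgraph.
_Contains_ : Graph → Graph → Set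
G Contains H = ∃ λ (f : Injection (Graph.vertices H) (Graph.vertices G)) →
  ∀ {u v} → Graph._~_ H u v →
  Graph._~_ G (Injection.to f u) (Injection.to f v)

Hypercube : ℕ → Graph
Hypercube d = record
  { vertices = setoid (Vec Bool d)
  ; _~_      = λ u v → ∃! _≡_ λ i → lookup u i ≢ lookup v i
  }

-- The bipartition A|B is stored by one of its parts; since A|B = B|A,
-- equality of splits is _≋_ rather than _≡_.
record Split (n : ℕ) : Set where
  field
    A          : Subset n
    A-nonempty : Nonempty A
    B-nonempty : Nonempty (∁ A)

  B : Subset n
  B = ∁ A

open Split

infix 4 _IsPartOf_ _≋_

_IsPartOf_ : ∀ {n} → Subset n → Split n → Set
P IsPartOf S = P ≡ A S ⊎ P ≡ B S

_≋_ : ∀ {n} → Split n → Split n → Set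
S ≋ T = A S IsPartOf T

-- The part S(x) of S containing x.
_at_ : ∀ {n} → Split n → Fin n → Subset n
S at x = if does (x ∈? A S) then A S else B S

-- A set of splits is given by an enumeration without repetitions.
record SplitSystem (n : ℕ) : Set where
  field
    size     : ℕ
    split    : Fin size → Split n
    distinct : ∀ {i j} → split i ≋ split j → i ≡ j
    trivial  : ∀ x → ∃ λ i → ⁅ x ⁆ IsPartOf split i

at-isPart : ∀ {n} (S : Split n) x → (S at x) IsPartOf S
at-isPart S x with x ∈? A S
... | yes _ = inj₁ refl
... | no  _ = inj₂ refl

x∈at : ∀ {n} (S : Split n) x → x ∈ S at x
x∈at S x with x ∈? A S
... | yes x∈A = x∈A
... | no  x∉A = x∉p⇒x∈∁p x∉A

module _ {n} (𝒮 : SplitSystem n) where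
  open SplitSystem 𝒮

  record BunemanVertex : Set where
    field
      φ  : Fin size → Subset n
      B1 : ∀ i → φ i IsPartOf split i
      B2 : ∀ {i j} → i ≢ j → Nonempty (φ i ∩ φ j)

  open BunemanVertex

  Buneman : Graph
  Buneman = record
    { vertices = On.setoid (Fin size →-setoid Subset n) φ
    ; _~_      = λ u v → ∃! _≡_ λ i → φ u i ≢ φ v i
    }

  φₓ : Fin n → BunemanVertex
  φₓ x = record
    { φ  = λ i → split i at x
    ; B1 = λ i → at-isPart (split i) x
    ; B2 = λ {i} {j} _ → x , x∈p∩q⁺ (x∈at (split i) x , x∈at (split j) x)
    }

  -- m is φ_Y, for a 3-element set Y.
  IsMedianOf : Subset n → BunemanVertex → Set
  IsMedianOf Y m = ∃ λ x → ∃ λ y → ∃ λ z →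
    Y ≡ ⁅ x ⁆ ∪ ⁅ y ⁆ ∪ ⁅ z ⁆ × IsMedian Buneman (φₓ x) (φₓ y) (φₓ z) m

  -- Buneman graphs are median graphs, so the vertices m and m′ below exist
  -- and are unique up to _≈_.
  IsInjective : Set
  IsInjective = ∀ {Y Y′} → ∣ Y ∣ ≡ 3 → ∣ Y′ ∣ ≡ 3 → Y ≢ Y′ →
    ∀ {m m′} → IsMedianOf Y m → IsMedianOf Y′ m′ →
    ¬ Graph._≈_ Buneman m m′

  -- For n ≥ 3 the Buneman graph has an edge, so a Buneman graph that is a
  -- tree has dimension 1.
  IsDimension : ℕ → Set
  IsDimension = IsMaximum λ d → Buneman Contains Hypercube d

IsInjectiveDimension : ℕ → ℕ → Set
IsInjectiveDimension n = IsMinimum λ d →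
  ∃ λ (𝒮 : SplitSystem n) → IsInjective 𝒮 × IsDimension 𝒮 d

{-# OPTIONS --safe #-}
module Submission where

-- A vertex of the Buneman graph chooses one side of every split.  Two vertices
-- are joined by a path of Hamming length, since among the splits where they
-- differ one whose chosen part is smallest can be switched; so the median of
-- three vertices is the majority vote.  Hence a system is injective if and only
-- if distinct triples are told apart by the majority side of some split, and,
-- since opposite edges of a square switch the same split, its dimension is the
-- largest number of pairwise incompatible splits.
--
-- Both conditions only involve finitely many bits, so for each n and d it is
-- decidable whether an injective system of dimension at most d exists, and
-- ID n is the least such d.  The upper bound ⌊n/2⌋ is given by the circular
-- splits (pairwise incompatible ones are pairwise crossing chords, which share
-- no endpoint), and ID 8 ≤ 3 by an explicit system.  For the lower bounds the
-- system is restricted to four or six points: telling a b x from a b y demands a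
-- split that separates a from b and x from y, and an exhaustive search shows
-- that these demands force two, respectively three, incompatible splits.

open import Algebra.Lattice.Properties.BooleanAlgebra using (¬-involutive)
open import Data.Bool using (Bool; true; false; not; _∧_; _∨_; _xor_; T; T?)
open import Data.Bool.ListAction using (any; all)
import Data.Bool.Properties as Bool
open import Data.Empty using (⊥)
open import Data.Fin using (Fin; zero; suc; toℕ; fromℕ; fromℕ<; inject≤; splitAt; funToFin; finToFun)
import Data.Fin as F
import Data.Fin.Properties as Fin
open import Data.Fin.Subset using (Subset; _∈_; _∉_; _⊆_; ∣_∣; ∁; ⁅_⁆; _∪_; Nonempty)
open import Data.Fin.Subset.Properties
open import Data.List as List using (List; []; _∷_; _++_; filter; filterᵇ; allFin; cartesianProduct; concatMap)
open import Data.List.Membership.Propositional using () renaming (_∈_ to _∈ᴸ_)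
open import Data.List.Membership.Propositional.Properties
  using (∈-++⁺ˡ; ∈-++⁺ʳ; ∈-map⁺; ∈-filter⁺; ∈-filter⁻; ∈-cartesianProduct⁺; ∈-allFin; ∈-lookup)
import Data.List.Relation.Unary.All as List∀
import Data.List.Relation.Unary.All.Properties as List∀
open import Data.List.Relation.Unary.AllPairs using ([]; _∷_)
import Data.List.Relation.Unary.Any as List∃
import Data.List.Relation.Unary.Any.Properties as List∃
open import Data.List.Relation.Unary.Unique.Propositional using (Unique)
import Data.List.Relation.Unary.Unique.Propositional.Properties as Unique
open import Data.Nat
  using (ℕ; zero; suc; _+_; _^_; _≤_; _<_; _≤?_; _<?_; z≤n; s≤s; s≤s⁻¹; ⌊_/2⌋)
import Data.Nat.Properties as ℕ
open import Data.Product using (∃; _×_; _,_; proj₁; proj₂; uncurry)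
open import Data.Sum as Sum using (_⊎_; inj₁; inj₂; [_,_]′)
open import Data.Vec
  using (Vec; []; _∷_; lookup; tabulate; replicate; take; _[_]≔_; here; there)
open import Data.Vec.Functional using (updateAt)
open import Data.Vec.Functional.Properties using (updateAt-updates; updateAt-minimal)
import Data.Vec.Properties as Vec
open import Data.Vec.Properties
  using (lookup∘tabulate; tabulate∘lookup; tabulate-cong; lookup-map; lookup-replicate;
         lookup∘update; lookup∘update′; []≔-commutes; lookup⇒[]=; []=⇒lookup)
open import Data.Vec.Relation.Unary.All as All using (All; []; _∷_)
import Data.Vec.Relation.Unary.All.Properties as All
open import Data.Vec.Relation.Unary.AllPairs as AllPairs using (AllPairs; []; _∷_; allPairs?)
import Data.Vec.Relation.Unary.AllPairs.Properties as AllPairs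
open import Function using (_∘_; id)
open import Function.Bundles using (Equivalence; Injection; Inverse)
open import Relation.Binary using (tri<; tri≈; tri>)
open import Relation.Binary.PropositionalEquality
open import Relation.Nullary
open import Relation.Nullary.Decidable
  using (_×-dec_; _→-dec_; _⊎-dec_; ¬?; map′; toWitness; dec-true; dec-false)
open import Relation.Unary using (Decidable)
open import Algebra.Properties.CommutativeMonoid.Sum ℕ.+-0-commutativeMonoid
  using (sum; sum-cong-≗; ∑-distrib-+; sum-replicate-zero)
open import Defs

-- Least witnesses and finite searches

least : ∀ {P : ℕ → Set} → Decidable P → ∀ {d} → P d → ∃ (IsMinimum P)
least {P} P? {d} Pd with P? 0
... | yes P0 = 0 , P0 , λ _ _ → z≤n
... | no ¬P0 with d | Pd
...   | zero  | P0 = contradiction P0 ¬P0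
...   | suc d′ | Psd with e , Pe , min ← least (P? ∘ suc) {d′} Psd =
  suc e , Pe , λ { zero P0 → contradiction P0 ¬P0 ; (suc j) Pj → s≤s (min j Pj) }

Searchable : Set → Set₁
Searchable A = ∀ {P : A → Set} → Decidable P → Dec (∃ P)

searchVec : ∀ {A} → Searchable A → ∀ k → Searchable (Vec A k)
searchVec search zero P? = map′ ([] ,_) (λ { ([] , p) → p }) (P? [])
searchVec search (suc k) P? =
  map′ (λ (x , v , p) → x ∷ v , p) (λ { (x ∷ v , p) → x , v , p })
    (search λ x → searchVec search k λ v → P? (x ∷ v))

all-Bool? : {P : Bool → Set} → Decidable P → Dec (∀ c → P c)
all-Bool? P? = map′ (λ { (f , t) false → f ; (f , t) true → t })
  (λ p → p false , p true) (P? false ×-dec P? true)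

-- Incompatible splits and majorities

-- a i x tells whether x lies in the stored part of the i-th split.
Sides : ℕ → ℕ → Set
Sides s n = Fin s → Fin n → Bool

Incompatible : ∀ {n} → (Fin n → Bool) → (Fin n → Bool) → Set
Incompatible a b = ∀ c d → ∃ λ x → a x ≡ c × b x ≡ d

incompatible? : ∀ {n} (a b : Fin n → Bool) → Dec (Incompatible a b)
incompatible? a b = all-Bool? λ c → all-Bool? λ d → Fin.any? λ x →
  (a x Bool.≟ c) ×-dec (b x Bool.≟ d)

-- Some quadrant is empty, say the one with `a x ≡ c` and `b x ≡ not d`; then the half `c` of `a`
-- lies inside the half `d` of `b`.
¬incompatible⇒below : ∀ {n} {a b : Fin n → Bool} → ¬ Incompatible a b →
  ∃ λ c → ∃ λ d → ∀ x → a x ≡ c → b x ≡ d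
¬incompatible⇒below {a = a} {b} ¬inc =
  let c , ¬c = ¬∀Bool (λ c → all-Bool? λ d → meets? c d) ¬inc
      d , ¬d = ¬∀Bool (meets? c) ¬c
  in c , not d , λ x eq → Bool.¬-not λ eq′ → ¬d (x , eq , eq′)
  where
  meets? : ∀ c d → Dec (∃ λ x → a x ≡ c × b x ≡ d)
  meets? c d = Fin.any? λ x → (a x Bool.≟ c) ×-dec (b x Bool.≟ d)
  ¬∀Bool : {P : Bool → Set} → Decidable P → ¬ (∀ c → P c) → ∃ λ c → ¬ P c
  ¬∀Bool P? ¬∀P with P? false
  ... | no ¬Pf = false , ¬Pf
  ... | yes Pf = true , λ Pt → ¬∀P λ { false → Pf ; true → Pt }

Incompatible-irrefl : ∀ {n} {a : Fin n → Bool} → ¬ Incompatible a a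
Incompatible-irrefl inc with inc true false
... | _ , p , q with () ← trans (sym p) q

Incompatible-sym : ∀ {n} {a b : Fin n → Bool} → Incompatible a b → Incompatible b a
Incompatible-sym inc c d = let x , p , q = inc d c in x , q , p

Incompatible-resp : ∀ {n} {a a′ b b′ : Fin n → Bool} → a ≗ a′ → b ≗ b′ →
  Incompatible a b → Incompatible a′ b′
Incompatible-resp p q inc c d =
  let x , ax≡c , bx≡d = inc c d in
  x , trans (sym (p x)) ax≡c , trans (sym (q x)) bx≡d

Incompatible-∘ : ∀ {m n} {a b : Fin n → Bool} (ι : Fin m → Fin n) →
  Incompatible (a ∘ ι) (b ∘ ι) → Incompatible a b
Incompatible-∘ ι inc c d = let x , p , q = inc c d in ι x , p , q

AllIncompatible : ∀ {s n k} → Sides s n → Vec (Fin s) k → Set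
AllIncompatible a = AllPairs λ i j → Incompatible (a i) (a j)

Clique : ∀ {s n} → Sides s n → ℕ → Set
Clique a d = ∃ λ (v : Vec _ d) → AllIncompatible a v

clique? : ∀ {s n} (a : Sides s n) → Decidable (Clique a)
clique? a d = searchVec Fin.any? d (allPairs? λ i j → incompatible? (a i) (a j))

Clique-≤ : ∀ {s n} {a : Sides s n} {d e} → e ≤ d → Clique a d → Clique a e
Clique-≤ {e = e} e≤d (v , inc) with k , refl ← ℕ.m≤n⇒∃[o]m+o≡n e≤d =
  take e v , AllPairs.take⁺ e inc

Clique-map : ∀ {s m n} {a : Sides s m} {b : Sides s n} {d} →
  (∀ {i j} → Incompatible (a i) (a j) → Incompatible (b i) (b j)) →
  Clique a d → Clique b d
Clique-map f (v , inc) = v , AllPairs.map f inc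

lookup-incompatible : ∀ {s n k} {a : Sides s n} {v : Vec (Fin s) k} →
  AllIncompatible a v →
  ∀ {i j} → i ≢ j → Incompatible (a (lookup v i)) (a (lookup v j))
lookup-incompatible (p ∷ _)   {zero}  {zero}  0≢0 = contradiction refl 0≢0
lookup-incompatible (p ∷ _)   {zero}  {suc j} _   = All.lookup⁺ p j
lookup-incompatible (p ∷ _)   {suc i} {zero}  _   = Incompatible-sym (All.lookup⁺ p i)
lookup-incompatible (_ ∷ inc) {suc i} {suc j} i≢j =
  lookup-incompatible inc (i≢j ∘ cong suc)

lookup-clique-injective : ∀ {s n k} {a : Sides s n} {v : Vec (Fin s) k} →
  AllIncompatible a v → ∀ {i j} → lookup v i ≡ lookup v j → i ≡ j
lookup-clique-injective {a = a} {v} inc {i} {j} eq with i Fin.≟ j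
... | yes i≡j = i≡j
... | no  i≢j = contradiction
  (subst (λ l → Incompatible (a (lookup v i)) (a l)) (sym eq) (lookup-incompatible inc i≢j))
  Incompatible-irrefl

-- The entries of a clique are distinct, so none has size `suc s`, and the search for a `d` without
-- a clique of size `suc d` succeeds. For the least such `d` a clique of size `d` exists: the empty
-- one if `d` is zero, and otherwise by minimality.
maxClique : ∀ {s n} (a : Sides s n) → ∃ λ d → Clique a d × ¬ Clique a (suc d)
maxClique {s} a
  with least (λ d → ¬? (clique? a (suc d))) {s}
    (λ (_ , inc) → ℕ.1+n≰n (Fin.injective⇒≤ (lookup-clique-injective {a = a} inc)))
... | zero  , ¬cl , _   = zero , ([] , []) , ¬cl
... | suc d , ¬cl , min = suc d , decidable-stable (clique? a (suc d))
  (λ ¬cl′ → ℕ.1+n≰n (min d ¬cl′)) , ¬cl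

maj : Bool → Bool → Bool → Bool
maj false b c = b ∧ c
maj true  b c = b ∨ c

Distinct : ∀ {n} → Fin n → Fin n → Fin n → Set
Distinct x y z = x ≢ y × x ≢ z × y ≢ z

distinct? : ∀ {n} (x y z : Fin n) → Dec (Distinct x y z)
distinct? x y z = ¬? (x Fin.≟ y) ×-dec ¬? (x Fin.≟ z) ×-dec ¬? (y Fin.≟ z)

majority : ∀ {n} → (Fin n → Bool) → Fin n → Fin n → Fin n → Bool
majority a x y z = maj (a x) (a y) (a z)

majority-cong : ∀ {n} {a b : Fin n → Bool} → a ≗ b →
  ∀ x y z → majority a x y z ≡ majority b x y z
majority-cong eq x y z rewrite eq x | eq y | eq z = refl

-- Two distinct triples may be ordered so that the first element of one is not
-- in the other.
Separating : ∀ {s n} → Sides s n → Set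
Separating {n = n} a = ∀ (x y z x′ y′ z′ : Fin n) → Distinct x y z → Distinct x′ y′ z′ →
  x ≢ x′ × x ≢ y′ × x ≢ z′ → ∃ λ i → majority (a i) x y z ≢ majority (a i) x′ y′ z′

separating? : ∀ {s n} (a : Sides s n) → Dec (Separating a)
separating? a =
  Fin.all? λ x → Fin.all? λ y → Fin.all? λ z →
  Fin.all? λ x′ → Fin.all? λ y′ → Fin.all? λ z′ →
  distinct? x y z →-dec distinct? x′ y′ z′ →-dec
  (¬? (x Fin.≟ x′) ×-dec ¬? (x Fin.≟ y′) ×-dec ¬? (x Fin.≟ z′)) →-dec
  Fin.any? λ i → ¬? (majority (a i) x y z Bool.≟ majority (a i) x′ y′ z′)

Separating-resp : ∀ {s n} {a b : Sides s n} → (∀ i → a i ≗ b i) → Separating a → Separating b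
Separating-resp eq sep x y z x′ y′ z′ p q r =
  let i , ≢maj = sep x y z x′ y′ z′ p q r in
  i , subst₂ _≢_ (majority-cong (eq i) x y z) (majority-cong (eq i) x′ y′ z′) ≢maj

Separating-∘ : ∀ {s m n} {a : Sides s n} {ι : Fin m → Fin n} → (∀ {x y} → ι x ≡ ι y → x ≡ y) →
  Separating a → Separating (λ i → a i ∘ ι)
Separating-∘ {ι = ι} inj sep x y z x′ y′ z′ p q (r , s , t) =
  sep (ι x) (ι y) (ι z) (ι x′) (ι y′) (ι z′) (distinct p) (distinct q)
    (r ∘ inj , s ∘ inj , t ∘ inj)
  where
  distinct : ∀ {x y z} → Distinct x y z → Distinct (ι x) (ι y) (ι z)
  distinct (p , q , r) = p ∘ inj , q ∘ inj , r ∘ inj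

-- Geodesics in the Buneman graph

sum-mono-≤ : ∀ {s} {f g : Fin s → ℕ} → (∀ i → f i ≤ g i) → sum f ≤ sum g
sum-mono-≤ {zero}  f≤g = z≤n
sum-mono-≤ {suc s} f≤g = ℕ.+-mono-≤ (f≤g zero) (sum-mono-≤ (f≤g ∘ suc))

-- A strict inequality in one term would make the sums strictly ordered. This turns a tight triangle
-- inequality between distances into a statement about each coordinate.
sum-mono-tight : ∀ {s} {f g : Fin s → ℕ} → (∀ i → f i ≤ g i) → sum g ≤ sum f → f ≗ g
sum-mono-tight {suc s} {f} {g} f≤g Σg≤Σf i with f zero ℕ.≟ g zero
... | no f₀≢g₀ = contradiction
  (ℕ.+-mono-<-≤ (ℕ.≤∧≢⇒< (f≤g zero) f₀≢g₀) (sum-mono-≤ (f≤g ∘ suc)))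
  (ℕ.≤⇒≯ Σg≤Σf)
sum-mono-tight f≤g Σg≤Σf zero    | yes f₀≡g₀ = f₀≡g₀
sum-mono-tight {f = f} {g} f≤g Σg≤Σf (suc i) | yes f₀≡g₀ =
  sum-mono-tight (f≤g ∘ suc)
    (ℕ.+-cancelˡ-≤ (f zero) _ _ (subst (λ c → c + sum (g ∘ suc) ≤ sum f) (sym f₀≡g₀) Σg≤Σf)) i

δ : Bool → Bool → ℕ
δ false false = 0
δ true  true  = 0
δ false true  = 1
δ true  false = 1

δ-refl : ∀ b → δ b b ≡ 0
δ-refl false = refl
δ-refl true  = refl

δ-≢ : ∀ {b c} → b ≢ c → δ b c ≡ 1
δ-≢ {false} {false} b≢c = contradiction refl b≢c
δ-≢ {true}  {true}  b≢c = contradiction refl b≢c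
δ-≢ {false} {true}  _   = refl
δ-≢ {true}  {false} _   = refl

δ≡0⇒≡ : ∀ {b c} → δ b c ≡ 0 → b ≡ c
δ≡0⇒≡ {false} {false} _ = refl
δ≡0⇒≡ {true}  {true}  _ = refl

δ-triangle : ∀ b c d → δ b d ≤ δ b c + δ c d
δ-triangle false false d     = ℕ.≤-refl
δ-triangle true  true  d     = ℕ.≤-refl
δ-triangle false true  false = z≤n
δ-triangle false true  true  = s≤s z≤n
δ-triangle true  false false = s≤s z≤n
δ-triangle true  false true  = z≤n

-- The Hamming distance.
dist : ∀ {s} → (Fin s → Bool) → (Fin s → Bool) → ℕ
dist σ τ = sum λ i → δ (σ i) (τ i)

≗⇒dist≡0 : ∀ {s} {σ τ : Fin s → Bool} → σ ≗ τ → dist σ τ ≡ 0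
≗⇒dist≡0 {s} {σ} {τ} eq = trans
  (sum-cong-≗ λ i → trans (cong (δ (σ i)) (sym (eq i))) (δ-refl (σ i))) (sum-replicate-zero s)

dist≡0⇒≗ : ∀ {s} {σ τ : Fin s → Bool} → dist σ τ ≡ 0 → σ ≗ τ
dist≡0⇒≗ {s} eq i = δ≡0⇒≡ (sym (sum-mono-tight (λ _ → z≤n)
  (ℕ.≤-reflexive (trans eq (sym (sum-replicate-zero s)))) i))

dist-triangle : ∀ {s} (σ τ υ : Fin s → Bool) → dist σ υ ≤ dist σ τ + dist τ υ
dist-triangle σ τ υ = ℕ.≤-trans (sum-mono-≤ λ i → δ-triangle (σ i) (τ i) (υ i))
  (ℕ.≤-reflexive (∑-distrib-+ (λ i → δ (σ i) (τ i)) (λ i → δ (τ i) (υ i))))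

Between : ∀ {s} (σ υ τ : Fin s → Bool) → Set
Between σ υ τ = ∀ i → τ i ≡ σ i ⊎ τ i ≡ υ i

between⇒dist : ∀ {s} {σ υ τ : Fin s → Bool} → Between σ υ τ → dist σ τ + dist τ υ ≡ dist σ υ
between⇒dist {σ = σ} {υ} {τ} between = trans
  (sym (∑-distrib-+ (λ i → δ (σ i) (τ i)) (λ i → δ (τ i) (υ i)))) (sum-cong-≗ pointwise)
  where
  pointwise : ∀ i → δ (σ i) (τ i) + δ (τ i) (υ i) ≡ δ (σ i) (υ i)
  pointwise i with between i
  ... | inj₁ eq rewrite eq | δ-refl (σ i) = refl
  ... | inj₂ eq rewrite eq | δ-refl (υ i) = ℕ.+-identityʳ _

-- The triangle inequality is tight in every coordinate; where `σ` and `υ` agree, neither leg has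
-- room to change the sign.
dist⇒agree : ∀ {s} {σ υ τ : Fin s → Bool} → dist σ τ + dist τ υ ≤ dist σ υ →
  ∀ i → σ i ≡ υ i → τ i ≡ σ i
dist⇒agree {σ = σ} {υ} {τ} tight i eq = sym (δ≡0⇒≡ (ℕ.m+n≡0⇒m≡0 _ (begin
  δ (σ i) (τ i) + δ (τ i) (υ i) ≡⟨ pointwise i ⟨
  δ (σ i) (υ i)                 ≡⟨ cong (δ (σ i)) eq ⟨
  δ (σ i) (σ i)                 ≡⟨ δ-refl (σ i) ⟩
  0                             ∎)))
  where
  open ≡-Reasoning
  pointwise = sum-mono-tight (λ i → δ-triangle (σ i) (τ i) (υ i))
    (subst (_≤ dist σ υ) (sym (∑-distrib-+ (λ i → δ (σ i) (τ i)) (λ i → δ (τ i) (υ i)))) tight)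

DiffersAt : ∀ {s} → Fin s → (σ τ : Fin s → Bool) → Set
DiffersAt i σ τ = σ i ≢ τ i × (∀ j → i ≢ j → σ j ≡ τ j)

differsAt⇒dist : ∀ {s} (i : Fin s) {σ τ} → DiffersAt i σ τ → dist σ τ ≡ 1
differsAt⇒dist zero    (ne , eq) =
  cong₂ _+_ (δ-≢ ne) (≗⇒dist≡0 λ j → eq (suc j) λ ())
differsAt⇒dist (suc i) {σ} {τ} (ne , eq) = cong₂ _+_
  (trans (cong (δ (σ zero)) (sym (eq zero λ ()))) (δ-refl (σ zero)))
  (differsAt⇒dist i (ne , λ j i≢j → eq (suc j) (i≢j ∘ Fin.suc-injective)))

≢-not : ∀ {b c : Bool} → b ≢ c → c ≡ not b
≢-not {b} {c} b≢c = Bool.¬-not (b≢c ∘ sym)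

-- Splits and Buneman vertices as signs

side : ∀ {n} → Split n → Fin n → Bool
side S = lookup (Split.A S)

half : ∀ {n} → Split n → Bool → Subset n
half S true  = Split.A S
half S false = Split.B S

∈half⇒ : ∀ {n} (S : Split n) b {x} → x ∈ half S b → side S x ≡ b
∈half⇒ S true  x∈ = []=⇒lookup x∈
∈half⇒ S false {x} x∈ = Bool.not-injective
  (trans (sym (lookup-map x not (Split.A S))) ([]=⇒lookup x∈))

⇒∈half : ∀ {n} (S : Split n) {b x} → side S x ≡ b → x ∈ half S b
⇒∈half S {true}  {x} eq = lookup⇒[]= x _ eq
⇒∈half S {false} {x} eq = lookup⇒[]= x _ (trans (lookup-map x not (Split.A S)) (cong not eq))

half-nonempty : ∀ {n} (S : Split n) b → ∃ λ x → side S x ≡ b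
half-nonempty S true  = let x , x∈ = Split.A-nonempty S in x , ∈half⇒ S true x∈
half-nonempty S false = let x , x∈ = Split.B-nonempty S in x , ∈half⇒ S false x∈

half-injective : ∀ {n} (S : Split n) {b c} → half S b ≡ half S c → b ≡ c
half-injective S {b} {c} eq =
  let x , p = half-nonempty S b in
  trans (sym p) (∈half⇒ S c (subst (x ∈_) eq (⇒∈half S p)))

half-isPart : ∀ {n} (S : Split n) b → half S b IsPartOf S
half-isPart S true  = inj₁ refl
half-isPart S false = inj₂ refl

∁-involutive : ∀ {n} (p : Subset n) → ∁ (∁ p) ≡ p
∁-involutive = ¬-involutive (∪-∩-booleanAlgebra _)

half≡⇒≋ : ∀ {n} (S T : Split n) b c → half S b ≡ half T c → S ≋ T
half≡⇒≋ S T true  true  eq = inj₁ eq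
half≡⇒≋ S T true  false eq = inj₂ eq
half≡⇒≋ S T false true  eq = inj₂ (trans (sym (∁-involutive _)) (cong ∁ eq))
half≡⇒≋ S T false false eq = inj₁ (trans (sym (∁-involutive _)) (trans (cong ∁ eq) (∁-involutive _)))

at≡half : ∀ {n} (S : Split n) x → S at x ≡ half S (side S x)
at≡half S x with x ∈? Split.A S
... | yes x∈A rewrite ∈half⇒ S true x∈A = refl
... | no  x∉A rewrite ∈half⇒ S false (x∉p⇒x∈∁p x∉A) = refl

-- A vertex is encoded by the Boolean sign of the part it chooses in each split.
module Signs {n} (𝒮 : SplitSystem n) where
  open SplitSystem 𝒮
  open BunemanVertex
  open Graph (Buneman 𝒮) using (Vertex; _~_; _≈_)

  sides : Sides size n
  sides i = side (split i)

  sign : Vertex → Fin size → Bool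
  sign v i with B1 v i
  ... | inj₁ _ = true
  ... | inj₂ _ = false

  φ≡half : ∀ v i → φ v i ≡ half (split i) (sign v i)
  φ≡half v i with B1 v i
  ... | inj₁ eq = eq
  ... | inj₂ eq = eq

  sign-unique : ∀ v {i b} → φ v i ≡ half (split i) b → sign v i ≡ b
  sign-unique v {i} eq = half-injective (split i) (trans (sym (φ≡half v i)) eq)

  φ≡⇒sign≡ : ∀ u v {i} → φ u i ≡ φ v i → sign u i ≡ sign v i
  φ≡⇒sign≡ u v {i} eq = sign-unique u (trans eq (φ≡half v i))

  sign≡⇒φ≡ : ∀ u v {i} → sign u i ≡ sign v i → φ u i ≡ φ v i
  sign≡⇒φ≡ u v {i} eq =
    trans (φ≡half u i) (trans (cong (half (split i)) eq) (sym (φ≡half v i)))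

  -- Condition (B2) in terms of signs; any choice of halves satisfies (B1).
  Consistent : (Fin size → Bool) → Set
  Consistent σ = ∀ {i j} → i ≢ j → ∃ λ x → sides i x ≡ σ i × sides j x ≡ σ j

  sign-consistent : ∀ v → Consistent (sign v)
  sign-consistent v {i} {j} i≢j =
    let x , x∈ = B2 v i≢j ; x∈i , x∈j = x∈p∩q⁻ (φ v i) (φ v j) x∈ in
    x , ∈half⇒ (split i) _ (subst (x ∈_) (φ≡half v i) x∈i)
      , ∈half⇒ (split j) _ (subst (x ∈_) (φ≡half v j) x∈j)

  vertex : (σ : Fin size → Bool) → Consistent σ → Vertex
  vertex σ con = record
    { φ  = λ i → half (split i) (σ i)
    ; B1 = λ i → half-isPart (split i) (σ i)
    ; B2 = λ {i} {j} i≢j → let x , p , q = con i≢j in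
        x , x∈p∩q⁺ (⇒∈half (split i) p , ⇒∈half (split j) q)
    }

  sign-vertex : ∀ σ (con : Consistent σ) → sign (vertex σ con) ≗ σ
  sign-vertex σ con i = sign-unique (vertex σ con) refl

  sign-φₓ : ∀ x i → sign (φₓ 𝒮 x) i ≡ sides i x
  sign-φₓ x i = sign-unique (φₓ 𝒮 x) (at≡half (split i) x)

  ~⇒differsAt : ∀ u v → u ~ v → ∃ λ i → DiffersAt i (sign u) (sign v)
  ~⇒differsAt u v (i , ne , unique) = i , ne ∘ sign≡⇒φ≡ u v , λ j i≢j →
    decidable-stable (sign u j Bool.≟ sign v j) λ ne′ → i≢j (unique (ne′ ∘ φ≡⇒sign≡ u v))

  differsAt⇒~ : ∀ u v {i} → DiffersAt i (sign u) (sign v) → u ~ v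
  differsAt⇒~ u v {i} (ne , eq) = i , ne ∘ φ≡⇒sign≡ u v , λ {j} ne′ →
    decidable-stable (i Fin.≟ j) λ i≢j → ne′ (sign≡⇒φ≡ u v (eq j i≢j))

  distance : Vertex → Vertex → ℕ
  distance u v = dist (sign u) (sign v)

  distance≤length : ∀ {u v l} → Walk (Buneman 𝒮) u v l → distance u v ≤ l
  distance≤length {u} {v} (stop u≈v) =
    ℕ.≤-reflexive (≗⇒dist≡0 λ i → φ≡⇒sign≡ u v (u≈v i))
  distance≤length {u} {w} (step {v = v} u~v walk) =
    let i , diff = ~⇒differsAt u v u~v in
    ℕ.≤-trans (dist-triangle (sign u) (sign v) (sign w))
      (ℕ.+-mono-≤ (ℕ.≤-reflexive (differsAt⇒dist i diff)) (distance≤length walk))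

  -- Among the splits where u and w differ, one whose part under u has least
  -- cardinality can be switched without violating (B2).
  switch : ∀ u w {k} → distance u w ≡ suc k →
    ∃ λ i → sign u i ≢ sign w i × Consistent (updateAt (sign u) i not)
  switch u w eq
    with j , j≢ ← Fin.¬∀⟶∃¬ size (λ i → sign u i ≡ sign w i) (λ i → sign u i Bool.≟ sign w i)
      (λ all → ℕ.1+n≢0 (trans (sym eq) (≗⇒dist≡0 all)))
    with _ , (i , i≢ , refl) , min ← least
      (λ c → Fin.any? λ i → ¬? (sign u i Bool.≟ sign w i) ×-dec (∣ half (split i) (sign u i) ∣ ℕ.≟ c))
      (j , j≢ , refl)
    = i , i≢ , consistent
    where
    part : Fin size → Subset n
    part j = half (split j) (sign u j)

    meets : ∀ {j} → i ≢ j → ∃ λ x → sides i x ≡ not (sign u i) × sides j x ≡ sign u j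
    meets {j} i≢j with sign u j Bool.≟ sign w j
    -- Here `w` already has the switched sign at `i` and shares the sign of `u` at `j`, so (B2) for
    -- `w` provides the point.
    ... | yes eq =
      let x , p , q = sign-consistent w i≢j in
      x , trans p (≢-not i≢) , trans q (sym eq)
    -- If the switched half of `i` missed `part j`, then `part j` would lie inside `part i`. As
    -- `part i` is smallest among the parts where `u` and `w` differ, the two would be equal,
    -- against distinctness of the splits.
    ... | no j≢ = decidable-stable
      (Fin.any? λ x → (sides i x Bool.≟ not (sign u i)) ×-dec (sides j x Bool.≟ sign u j))
      λ none →
        let part-j⊆part-i : part j ⊆ part i
            part-j⊆part-i {x} x∈ = ⇒∈half (split i) (decidable-stable (sides i x Bool.≟ sign u i)
              λ ne → none (x , ≢-not (ne ∘ sym) , ∈half⇒ (split j) _ x∈))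
            part-i⊆part-j : part i ⊆ part j
            part-i⊆part-j {x} x∈ = decidable-stable (x ∈? part j) λ x∉ →
              ℕ.<⇒≱ (p⊂q⇒∣p∣<∣q∣ (part-j⊆part-i , x , x∈ , x∉)) (min _ (j , j≢ , refl))
        in i≢j (distinct (half≡⇒≋ (split i) (split j) (sign u i) (sign u j) (⊆-antisym part-i⊆part-j part-j⊆part-i)))

    updated : ∀ {j} → i ≢ j → updateAt (sign u) i not j ≡ sign u j
    updated {j} i≢j = updateAt-minimal j i (sign u) (i≢j ∘ sym)

    consistent : Consistent (updateAt (sign u) i not)
    consistent {j} {k} j≢k with i Fin.≟ j | i Fin.≟ k
    ... | yes refl | yes refl = contradiction refl j≢k
    ... | yes refl | no i≢k =
      let x , p , q = meets i≢k in
      x , trans p (sym (updateAt-updates i (sign u))) , trans q (sym (updated i≢k))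
    ... | no i≢j | yes refl =
      let x , p , q = meets i≢j in
      x , trans q (sym (updated i≢j)) , trans p (sym (updateAt-updates i (sign u)))
    ... | no i≢j | no i≢k =
      let x , p , q = sign-consistent u j≢k in
      x , trans p (sym (updated i≢j)) , trans q (sym (updated i≢k))

  -- Switching one split takes `u` to a neighbour `v` between `u` and `w`. The distances through `v`
  -- add up and the first is 1, so `v` is closer to `w` by exactly one.
  geodesic : ∀ u w {k} → distance u w ≡ k → Walk (Buneman 𝒮) u w k
  geodesic u w {zero}  eq = stop λ i → sign≡⇒φ≡ u w (dist≡0⇒≗ eq i)
  geodesic u w {suc k} eq =
    step {v = v} (differsAt⇒~ u v diff)
      (geodesic v w (ℕ.suc-injective (trans (cong (_+ distance v w) (sym (differsAt⇒dist i diff)))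
        (trans (between⇒dist between) eq))))
    where
    i   = proj₁ (switch u w eq)
    i≢  = proj₁ (proj₂ (switch u w eq))
    con = proj₂ (proj₂ (switch u w eq))
    v : Vertex
    v = vertex _ con
    at-i : sign v i ≡ not (sign u i)
    at-i = trans (sign-vertex _ con i) (updateAt-updates i (sign u))
    elsewhere : ∀ j → i ≢ j → sign u j ≡ sign v j
    elsewhere j i≢j = sym (trans (sign-vertex _ con j) (updateAt-minimal j i (sign u) (i≢j ∘ sym)))
    diff : DiffersAt i (sign u) (sign v)
    diff = (λ eq → Bool.not-¬ refl (trans eq at-i)) , elsewhere
    between : Between (sign u) (sign w) (sign v)
    between j with i Fin.≟ j
    ... | yes refl = inj₂ (trans at-i (sym (≢-not i≢)))
    ... | no  i≢j  = inj₁ (sym (elsewhere j i≢j))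

  -- Since `geodesic` attains the Hamming distance, the walks through `m` are no longer than it, and
  -- the triangle inequality at `m` is tight.
  onShortestPath⇒agree : ∀ u w m → OnShortestPath (Buneman 𝒮) u w m →
    ∀ i → sign u i ≡ sign w i → sign m i ≡ sign u i
  onShortestPath⇒agree u w m (k , l , walk , walk′ , shortest) = dist⇒agree
    (ℕ.≤-trans (ℕ.+-mono-≤ (distance≤length walk) (distance≤length walk′)) (shortest (geodesic u w refl)))

  between⇒onShortestPath : ∀ u w m → Between (sign u) (sign w) (sign m) →
    OnShortestPath (Buneman 𝒮) u w m
  between⇒onShortestPath u w m between =
    _ , _ , geodesic u m refl , geodesic m w refl ,
    λ walk → ℕ.≤-trans (ℕ.≤-reflexive (between⇒dist between)) (distance≤length walk)

-- Medians and hypercubes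

maj-comm₁₂ : ∀ a b c → maj a b c ≡ maj b a c
maj-comm₁₂ false false c = refl
maj-comm₁₂ false true  c = refl
maj-comm₁₂ true  false c = refl
maj-comm₁₂ true  true  c = refl

maj-comm₂₃ : ∀ a b c → maj a b c ≡ maj a c b
maj-comm₂₃ false b c = Bool.∧-comm b c
maj-comm₂₃ true  b c = Bool.∨-comm b c

-- The three hypotheses are what lying on the three geodesics means in a single coordinate; of three
-- Booleans, two always agree.
maj-unique : ∀ a b c m → (a ≡ b → m ≡ a) → (b ≡ c → m ≡ b) → (a ≡ c → m ≡ a) → m ≡ maj a b c
maj-unique false false c     m p q r = p refl
maj-unique false true  false m p q r = r refl
maj-unique false true  true  m p q r = q refl
maj-unique true  false false m p q r = q refl
maj-unique true  false true  m p q r = r refl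
maj-unique true  true  c     m p q r = p refl

maj-majority : ∀ a b c → let m = maj a b c in
  (a ≡ m × b ≡ m) ⊎ (a ≡ m × c ≡ m) ⊎ (b ≡ m × c ≡ m)
maj-majority false false c     = inj₁ (refl , refl)
maj-majority false true  false = inj₂ (inj₁ (refl , refl))
maj-majority false true  true  = inj₂ (inj₂ (refl , refl))
maj-majority true  false false = inj₂ (inj₂ (refl , refl))
maj-majority true  false true  = inj₂ (inj₁ (refl , refl))
maj-majority true  true  c     = inj₁ (refl , refl)

maj-selects : ∀ a b c → (maj a b c ≡ a ⊎ maj a b c ≡ b) ×
  (maj a b c ≡ b ⊎ maj a b c ≡ c) × (maj a b c ≡ a ⊎ maj a b c ≡ c)
maj-selects a b c with maj-majority a b c
... | inj₁ (p , q)        = inj₁ (sym p) , inj₁ (sym q) , inj₁ (sym p)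
... | inj₂ (inj₁ (p , q)) = inj₁ (sym p) , inj₂ (sym q) , inj₁ (sym p)
... | inj₂ (inj₂ (p , q)) = inj₂ (sym p) , inj₁ (sym p) , inj₂ (sym q)

triple : ∀ {n} → Fin n → Fin n → Fin n → Subset n
triple x y z = ⁅ x ⁆ ∪ ⁅ y ⁆ ∪ ⁅ z ⁆

∈triple⁻ : ∀ {n} {w x y z : Fin n} → w ∈ triple x y z → w ≡ x ⊎ w ≡ y ⊎ w ≡ z
∈triple⁻ w∈ = Sum.map (x∈⁅y⁆⇒x≡y _) (Sum.map (x∈⁅y⁆⇒x≡y _) (x∈⁅y⁆⇒x≡y _) ∘ x∈p∪q⁻ _ _)
  (x∈p∪q⁻ _ _ w∈)

∈triple⁺ : ∀ {n} {w x y z : Fin n} → w ≡ x ⊎ w ≡ y ⊎ w ≡ z → w ∈ triple x y z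
∈triple⁺ (inj₁ refl)        = x∈p∪q⁺ (inj₁ (x∈⁅x⁆ _))
∈triple⁺ (inj₂ (inj₁ refl)) = x∈p∪q⁺ (inj₂ (x∈p∪q⁺ (inj₁ (x∈⁅x⁆ _))))
∈triple⁺ (inj₂ (inj₂ refl)) = x∈p∪q⁺ (inj₂ (x∈p∪q⁺ (inj₂ (x∈⁅x⁆ _))))

∣⁅x⁆∪p∣≤1+∣p∣ : ∀ {n} (x : Fin n) (p : Subset n) → ∣ ⁅ x ⁆ ∪ p ∣ ≤ suc ∣ p ∣
∣⁅x⁆∪p∣≤1+∣p∣ zero    (b ∷ p)     rewrite ∪-identityˡ p = s≤s (∣p∣≤∣x∷p∣ b p)
∣⁅x⁆∪p∣≤1+∣p∣ (suc x) (false ∷ p) = ∣⁅x⁆∪p∣≤1+∣p∣ x p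
∣⁅x⁆∪p∣≤1+∣p∣ (suc x) (true ∷ p)  = s≤s (∣⁅x⁆∪p∣≤1+∣p∣ x p)

x∉p⇒∣⁅x⁆∪p∣≡1+∣p∣ : ∀ {n} (x : Fin n) (p : Subset n) → x ∉ p → ∣ ⁅ x ⁆ ∪ p ∣ ≡ suc ∣ p ∣
x∉p⇒∣⁅x⁆∪p∣≡1+∣p∣ zero    (true ∷ p)  x∉p = contradiction here x∉p
x∉p⇒∣⁅x⁆∪p∣≡1+∣p∣ zero    (false ∷ p) x∉p rewrite ∪-identityˡ p = refl
x∉p⇒∣⁅x⁆∪p∣≡1+∣p∣ (suc x) (false ∷ p) x∉p = x∉p⇒∣⁅x⁆∪p∣≡1+∣p∣ x p (x∉p ∘ there)
x∉p⇒∣⁅x⁆∪p∣≡1+∣p∣ (suc x) (true ∷ p)  x∉p =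
  cong suc (x∉p⇒∣⁅x⁆∪p∣≡1+∣p∣ x p (x∉p ∘ there))

distinct⇒∣triple∣≡3 : ∀ {n} {x y z : Fin n} → Distinct x y z → ∣ triple x y z ∣ ≡ 3
distinct⇒∣triple∣≡3 {x = x} {y} {z} (x≢y , x≢z , y≢z) =
  trans (x∉p⇒∣⁅x⁆∪p∣≡1+∣p∣ x _ ([ x≢y ∘ x∈⁅y⁆⇒x≡y _ , x≢z ∘ x∈⁅y⁆⇒x≡y _ ]′ ∘ x∈p∪q⁻ _ _))
    (cong suc (trans (x∉p⇒∣⁅x⁆∪p∣≡1+∣p∣ y _ (y≢z ∘ x∈⁅y⁆⇒x≡y _)) (cong suc (∣⁅x⁆∣≡1 z))))

-- If two of the points coincided, the triple would lie in a set `⁅ v ⁆ ∪ ⁅ w ⁆`, which has at most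
-- two elements.
∣triple∣≡3⇒distinct : ∀ {n} (x y z : Fin n) → ∣ triple x y z ∣ ≡ 3 → Distinct x y z
∣triple∣≡3⇒distinct x y z eq =
    (λ { refl → two x z [ inj₁ , id ]′ })
  , (λ { refl → two x y [ inj₁ , [ inj₂ , inj₁ ]′ ]′ })
  , (λ { refl → two x y [ inj₁ , [ inj₂ , inj₂ ]′ ]′ })
  where
  two : ∀ v w → (∀ {u} → u ≡ x ⊎ u ≡ y ⊎ u ≡ z → u ≡ v ⊎ u ≡ w) → ⊥
  two v w f = ℕ.<⇒≱ (ℕ.≤-refl {3}) (begin
    3                   ≡⟨ eq ⟨
    ∣ triple x y z ∣    ≤⟨ p⊆q⇒∣p∣≤∣q∣ (λ u∈ → x∈p∪q⁺ (Sum.map pt pt (f (∈triple⁻ u∈)))) ⟩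
    ∣ ⁅ v ⁆ ∪ ⁅ w ⁆ ∣   ≤⟨ ∣⁅x⁆∪p∣≤1+∣p∣ v ⁅ w ⁆ ⟩
    suc ∣ ⁅ w ⁆ ∣       ≡⟨ cong suc (∣⁅x⁆∣≡1 w) ⟩
    2                   ∎)
    where
    open ℕ.≤-Reasoning
    pt : ∀ {u v} → u ≡ v → u ∈ ⁅ v ⁆
    pt refl = x∈⁅x⁆ _

-- Otherwise `p` would be a proper subset of `q`. Supplies the point of one triple outside the other
-- that `Separating` asks for.
⊈-of-equal-size : ∀ {n} {p q : Subset n} → ∣ p ∣ ≡ ∣ q ∣ → p ≢ q → ∃ λ x → x ∈ p × x ∉ q
⊈-of-equal-size {p = p} {q} ∣p∣≡∣q∣ p≢q =
  decidable-stable (Fin.any? λ x → (x ∈? p) ×-dec ¬? (x ∈? q)) λ none →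
  let p⊆q : p ⊆ q
      p⊆q {x} x∈p = decidable-stable (x ∈? q) λ x∉q → none (x , x∈p , x∉q)
      q⊆p : q ⊆ p
      q⊆p {x} x∈q = decidable-stable (x ∈? p) λ x∉p →
        ℕ.<-irrefl ∣p∣≡∣q∣ (p⊂q⇒∣p∣<∣q∣ (p⊆q , x , x∈q , x∉p))
  in p≢q (⊆-antisym p⊆q q⊆p)

module Medians {n} (𝒮 : SplitSystem n) where
  open SplitSystem 𝒮
  open Signs 𝒮
  open Graph (Buneman 𝒮) using (Vertex)

  median⇒majority : ∀ x y z m → IsMedian (Buneman 𝒮) (φₓ 𝒮 x) (φₓ 𝒮 y) (φₓ 𝒮 z) m →
    ∀ i → sign m i ≡ majority (sides i) x y z
  median⇒majority x y z m (p , q , r) i =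
    maj-unique _ _ _ _ (agree p) (agree q) (agree r)
    where
    agree : ∀ {x y} → OnShortestPath (Buneman 𝒮) (φₓ 𝒮 x) (φₓ 𝒮 y) m →
      sides i x ≡ sides i y → sign m i ≡ sides i x
    agree {x} {y} p eq = trans
      (onShortestPath⇒agree (φₓ 𝒮 x) (φₓ 𝒮 y) m p i
        (trans (sign-φₓ x i) (trans eq (sym (sign-φₓ y i)))))
      (sign-φₓ x i)

  -- Each majority is supported by at least two of the three points, and two such pairs share a
  -- point, which lies in both chosen halves.
  majority-consistent : ∀ x y z → Consistent λ i → majority (sides i) x y z
  majority-consistent x y z {i} {j} _
    with maj-majority (sides i x) (sides i y) (sides i z)
       | maj-majority (sides j x) (sides j y) (sides j z)
  ... | inj₁ (p , _)        | inj₁ (q , _)        = x , p , q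
  ... | inj₁ (p , _)        | inj₂ (inj₁ (q , _)) = x , p , q
  ... | inj₁ (_ , p)        | inj₂ (inj₂ (q , _)) = y , p , q
  ... | inj₂ (inj₁ (p , _)) | inj₁ (q , _)        = x , p , q
  ... | inj₂ (inj₁ (p , _)) | inj₂ (inj₁ (q , _)) = x , p , q
  ... | inj₂ (inj₁ (_ , p)) | inj₂ (inj₂ (_ , q)) = z , p , q
  ... | inj₂ (inj₂ (p , _)) | inj₁ (_ , q)        = y , p , q
  ... | inj₂ (inj₂ (_ , p)) | inj₂ (inj₁ (_ , q)) = z , p , q
  ... | inj₂ (inj₂ (p , _)) | inj₂ (inj₂ (q , _)) = y , p , q

  median : Fin n → Fin n → Fin n → Vertex
  median x y z = vertex _ (majority-consistent x y z)

  median-isMedian : ∀ x y z →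
    IsMedian (Buneman 𝒮) (φₓ 𝒮 x) (φₓ 𝒮 y) (φₓ 𝒮 z) (median x y z)
  median-isMedian x y z =
      between x y (λ i → proj₁ (selects i))
    , between y z (λ i → proj₁ (proj₂ (selects i)))
    , between x z (λ i → proj₂ (proj₂ (selects i)))
    where
    selects = λ i → maj-selects (sides i x) (sides i y) (sides i z)
    between : ∀ u v → (∀ i → majority (sides i) x y z ≡ sides i u ⊎ majority (sides i) x y z ≡ sides i v) →
      OnShortestPath (Buneman 𝒮) (φₓ 𝒮 u) (φₓ 𝒮 v) (median x y z)
    between u v sel = between⇒onShortestPath (φₓ 𝒮 u) (φₓ 𝒮 v) (median x y z) λ i →
      Sum.map (pick u i) (pick v i) (sel i)
      where
      pick : ∀ u i → majority (sides i) x y z ≡ sides i u → sign (median x y z) i ≡ sign (φₓ 𝒮 u) i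
      pick u i eq = trans (sign-vertex _ (majority-consistent x y z) i) (trans eq (sym (sign-φₓ u i)))

  -- If every split gave both triples the same majority, their medians would choose the same halves
  -- throughout.
  injective⇒separating : IsInjective 𝒮 → Separating sides
  injective⇒separating inj x y z x′ y′ z′ xyz xyz′ (x≢x′ , x≢y′ , x≢z′) =
    Fin.¬∀⟶∃¬ size _ (λ i → majority (sides i) x y z Bool.≟ majority (sides i) x′ y′ z′)
      λ same → inj (distinct⇒∣triple∣≡3 xyz) (distinct⇒∣triple∣≡3 xyz′)
        (λ eq → [ x≢x′ , [ x≢y′ , x≢z′ ]′ ]′ (∈triple⁻ (subst (x ∈_) eq (∈triple⁺ (inj₁ refl)))))
        (x , y , z , refl , median-isMedian x y z)
        (x′ , y′ , z′ , refl , median-isMedian x′ y′ z′)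
        λ i → cong (half (split i)) (same i)

  -- Some `w` in `Y` lies outside `Y′`. Majorities are symmetric, so `Y` may be reordered to start
  -- with `w`, as `Separating` requires.
  separating⇒injective : Separating sides → IsInjective 𝒮
  separating⇒injective sep {Y} {Y′} ∣Y∣≡3 ∣Y′∣≡3 Y≢Y′ {m} {m′}
    (x , y , z , refl , med) (x′ , y′ , z′ , refl , med′) m≈m′ =
    let w , w∈ , w∉ = ⊈-of-equal-size (trans ∣Y∣≡3 (sym ∣Y′∣≡3)) Y≢Y′
        x≢y , x≢z , y≢z = ∣triple∣≡3⇒distinct x y z ∣Y∣≡3
        outside : w ≢ x′ × w ≢ y′ × w ≢ z′
        outside = w∉ ∘ ∈triple⁺ ∘ inj₁ , w∉ ∘ ∈triple⁺ ∘ inj₂ ∘ inj₁ , w∉ ∘ ∈triple⁺ ∘ inj₂ ∘ inj₂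
        separate : ∀ u v → Distinct w u v →
          ¬ (∀ i → majority (sides i) w u v ≡ majority (sides i) x y z)
        separate u v dist eq =
          let i , ne = sep w u v x′ y′ z′ dist (∣triple∣≡3⇒distinct x′ y′ z′ ∣Y′∣≡3) outside
          in ne (trans (eq i) (same i))
    in case w separate (∈triple⁻ w∈) x≢y x≢z y≢z
    where
    same : ∀ i → majority (sides i) x y z ≡ majority (sides i) x′ y′ z′
    same i = begin
      majority (sides i) x y z      ≡⟨ median⇒majority x y z m med i ⟨
      sign m i                      ≡⟨ φ≡⇒sign≡ m m′ (m≈m′ i) ⟩
      sign m′ i                     ≡⟨ median⇒majority x′ y′ z′ m′ med′ i ⟩
      majority (sides i) x′ y′ z′   ∎
      where open ≡-Reasoning
    case : ∀ w → (∀ u v → Distinct w u v →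
          ¬ (∀ i → majority (sides i) w u v ≡ majority (sides i) x y z)) →
      w ≡ x ⊎ w ≡ y ⊎ w ≡ z → x ≢ y → x ≢ z → y ≢ z → ⊥
    case w sep (inj₁ refl) x≢y x≢z y≢z = sep y z (x≢y , x≢z , y≢z) λ _ → refl
    case w sep (inj₂ (inj₁ refl)) x≢y x≢z y≢z =
      sep x z (x≢y ∘ sym , y≢z , x≢z) λ i → maj-comm₁₂ (sides i y) (sides i x) (sides i z)
    case w sep (inj₂ (inj₂ refl)) x≢y x≢z y≢z =
      sep x y (x≢z ∘ sym , y≢z ∘ sym , x≢y) λ i →
        trans (maj-comm₁₂ (sides i z) (sides i x) (sides i y))
          (maj-comm₂₃ (sides i x) (sides i z) (sides i y))

differsAt-unique : ∀ {s} {i : Fin s} {σ τ υ} → DiffersAt i σ τ → DiffersAt i σ υ → τ ≗ υ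
differsAt-unique {i = i} (p , f) (q , g) j with i Fin.≟ j
... | yes refl = trans (≢-not p) (sym (≢-not q))
... | no  i≢j  = trans (sym (f j i≢j)) (g j i≢j)

differsAt-sym : ∀ {s} {i : Fin s} {σ τ} → DiffersAt i σ τ → DiffersAt i τ σ
differsAt-sym (p , f) = p ∘ sym , λ j i≢j → sym (f j i≢j)

false≢true : false ≢ true
false≢true ()

update-adjacent : ∀ {d} (u : Vec Bool d) k → lookup u k ≡ false →
  Graph._~_ (Hypercube d) u (u [ k ]≔ true)
update-adjacent u k eq = k , (λ eq′ → false≢true (trans (sym eq) (trans eq′ (lookup∘update k u true))))
  , λ {l} ne → decidable-stable (k Fin.≟ l) λ k≢l → ne (sym (lookup∘update′ (k≢l ∘ sym) u true))

module Dimension {n} (𝒮 : SplitSystem n) where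
  open SplitSystem 𝒮
  open Signs 𝒮
  open Graph (Buneman 𝒮) using (Vertex; _~_; _≈_)

  signs≗⇒≈ : ∀ u v → sign u ≗ sign v → u ≈ v
  signs≗⇒≈ u v eq i = sign≡⇒φ≡ u v (eq i)

  -- In a 4-cycle of the Buneman graph opposite edges switch the same split.
  square⇒incompatible : ∀ p q r t {i j} → DiffersAt i (sign p) (sign q) →
    DiffersAt j (sign p) (sign r) → q ~ t → r ~ t → ¬ q ≈ r → ¬ p ≈ t →
    Incompatible (sides i) (sides j)
  square⇒incompatible p q r t {i} {j} pq pr q~t r~t q≉r p≉t c d = corner
    where
    i≢j : i ≢ j
    i≢j refl = q≉r (signs≗⇒≈ q r (differsAt-unique pq pr))

    -- The edge from `q` to `t` cannot switch `i` again: that would undo the edge from `p` to `q`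
    -- and make `t` equal to `p`.
    opposite : ∀ q → q ~ t → ∀ {i} → DiffersAt i (sign p) (sign q) → sign q i ≡ sign t i
    opposite q q~t {i} pq =
      let k , qt = ~⇒differsAt q t q~t in
      proj₂ qt i λ { refl → p≉t (signs≗⇒≈ p t (differsAt-unique (differsAt-sym pq) qt)) }

    ≢≢⇒≡ : ∀ {a b c : Bool} → a ≢ b → b ≢ c → c ≡ a
    ≢≢⇒≡ a≢b b≢c = trans (≢-not b≢c) (sym (≢-not (a≢b ∘ sym)))

    at : ∀ v → sign v i ≡ c → sign v j ≡ d → ∃ λ x → sides i x ≡ c × sides j x ≡ d
    at v eq eq′ = let x , e , e′ = sign-consistent v i≢j in x , trans e eq , trans e′ eq′

    corner : ∃ λ x → sides i x ≡ c × sides j x ≡ d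
    -- Relative to `p`, the vertices `q`, `r` and `t` have switched `i`, `j` and both, so the four
    -- corners realise all pairs of signs; (B2) at the right corner gives the point.
    corner with c Bool.≟ sign p i | d Bool.≟ sign p j
    ... | yes c≡ | yes d≡ = at p (sym c≡) (sym d≡)
    ... | no  c≢ | yes d≡ = at q (≢≢⇒≡ c≢ (proj₁ pq)) (trans (sym (proj₂ pq j i≢j)) (sym d≡))
    ... | yes c≡ | no  d≢ = at r (trans (sym (proj₂ pr i (i≢j ∘ sym))) (sym c≡)) (≢≢⇒≡ d≢ (proj₁ pr))
    ... | no  c≢ | no  d≢ = at t
      (trans (sym (opposite q q~t pq)) (≢≢⇒≡ c≢ (proj₁ pq)))
      (trans (sym (opposite r r~t pr)) (≢≢⇒≡ d≢ (proj₁ pr)))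

  -- The `d` edges at the all-false corner `o` of the cube switch one split each. Any two of them
  -- span a square, and injectivity keeps its opposite corners apart.
  contains⇒clique : ∀ {d} → Buneman 𝒮 Contains Hypercube d → Clique sides d
  contains⇒clique {d} (f , adj) = tabulate direction , AllPairs.tabulate⁺ incompatible
    where
    open Injection f using (to; injective)
    o : Vec Bool d
    o = replicate d false
    e : Fin d → Vec Bool d
    e k = o [ k ]≔ true

    o~e : ∀ k → Graph._~_ (Hypercube d) o (e k)
    o~e k = update-adjacent o k (lookup-replicate k false)

    e-off : ∀ {k l} → k ≢ l → lookup (e k) l ≡ false
    e-off {k} {l} k≢l = trans (lookup∘update′ (k≢l ∘ sym) o true) (lookup-replicate l false)

    differs : ∀ k → ∃ λ i → DiffersAt i (sign (to o)) (sign (to (e k)))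
    differs k = ~⇒differsAt (to o) (to (e k)) (adj (o~e k))

    direction : Fin d → Fin size
    direction = proj₁ ∘ differs

    incompatible : ∀ {k l} → k ≢ l → Incompatible (sides (direction k)) (sides (direction l))
    incompatible {k} {l} k≢l = square⇒incompatible (to o) (to (e k)) (to (e l)) (to (e k [ l ]≔ true))
      (proj₂ (differs k)) (proj₂ (differs l))
      (adj (update-adjacent (e k) l (e-off k≢l)))
      (adj (subst (Graph._~_ (Hypercube d) (e l)) ([]≔-commutes o l k (k≢l ∘ sym))
        (update-adjacent (e l) k (e-off (k≢l ∘ sym)))))
      (λ eq → false≢true (trans (sym (e-off k≢l)) (trans (cong (λ v → lookup v l) (injective eq)) (lookup∘update l o true))))
      (λ eq → false≢true (trans (sym (lookup-replicate l false))
        (trans (cong (λ v → lookup v l) (injective eq)) (lookup∘update l (e k) true))))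

  module Cube {d} {v : Vec (Fin size) d} (inc : AllIncompatible sides v)
    (maximal : ¬ Clique sides (suc d)) where

    Below : Fin d → Bool → Fin size → Bool → Set
    Below k c j b = ∀ x → sides (lookup v k) x ≡ c → sides j x ≡ b

    Proper : Fin d → Bool → Fin size → Bool → Set
    Proper k c j b = ∃ λ x → sides j x ≡ b × sides (lookup v k) x ≢ c

    -- The splits outside the maximal clique v are constant over the hypercube:
    -- some half of each of them properly contains a half of a member of v.
    data Position (j : Fin size) : Set where
      member   : ∀ k → lookup v k ≡ j → Position j
      external : (∀ k → lookup v k ≢ j) → ∀ k c b → Below k c j b → Proper k c j b → Position j

    -- A split outside `v` is not incompatible with every member, for it would extend the clique; so
    -- one of its halves contains a half of some member, properly because the splits differ.
    position : ∀ j → Position j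
    position j with Fin.any? (λ k → lookup v k Fin.≟ j)
    ... | yes (k , eq) = member k eq
    ... | no ∄ =
      let j∉v : ∀ k → lookup v k ≢ j
          j∉v k eq = ∄ (k , eq)
          k , ¬inc = Fin.¬∀⟶∃¬ d (λ k → Incompatible (sides j) (sides (lookup v k)))
            (λ k → incompatible? (sides j) (sides (lookup v k)))
            λ all → maximal (j ∷ v , All.lookup⁻ all ∷ inc)
          c , b , below = ¬incompatible⇒below (¬inc ∘ Incompatible-sym)
      in external j∉v k c b below (proper (j∉v k) below)
      where
      proper : ∀ {k c b} → lookup v k ≢ j → Below k c j b → Proper k c j b
      proper {k} {c} {b} vk≢j below = decidable-stable
        (Fin.any? λ x → (sides j x Bool.≟ b) ×-dec ¬? (sides (lookup v k) x Bool.≟ c))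
        λ none → vk≢j (distinct (half≡⇒≋ (split (lookup v k)) (split j) c b (⊆-antisym
          (λ x∈ → ⇒∈half (split j) (below _ (∈half⇒ (split (lookup v k)) c x∈)))
          (λ {x} x∈ → ⇒∈half (split (lookup v k)) (decidable-stable (sides (lookup v k) x Bool.≟ c)
            λ ne → none (x , ∈half⇒ (split j) b x∈ , ne))))))

    bit : ∀ {j} → Position j → Vec Bool d → Bool
    bit (member k _)           β = lookup β k
    bit (external _ _ _ b _ _) β = b

    -- Treats members and external splits alike: the half `b` of `j` contains the half `c` of a
    -- member, either properly or because `j` is that member and `c` its bit in `β`.
    record Anchor (β : Vec Bool d) (j : Fin size) (b : Bool) : Set where
      constructor anchor
      field
        k : Fin d
        c : Bool
        below : Below k c j b
        kind : Proper k c j b ⊎ (lookup v k ≡ j × c ≡ lookup β k)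

    anchored : ∀ β {j} (p : Position j) → Anchor β j (bit p β)
    anchored β (member k refl)                     = anchor k _ (λ _ → id) (inj₂ (refl , refl))
    anchored β (external _ k c b below proper) = anchor k c below (inj₁ proper)

    -- It suffices to find a point in both anchoring halves, or near enough. Halves of two different
    -- members meet by incompatibility, equal halves are non-empty, and for opposite halves of one
    -- member a proper inclusion provides a point across. Without a proper inclusion `i` and `j`
    -- would both be that member.
    anchors-meet : ∀ {β i j b b′} → i ≢ j → Anchor β i b → Anchor β j b′ →
      ∃ λ x → sides i x ≡ b × sides j x ≡ b′
    anchors-meet i≢j (anchor k c below kind) (anchor l c′ below′ kind′) with k Fin.≟ l
    ... | no k≢l =
      let x , p , q = lookup-incompatible inc k≢l c c′ in x , below x p , below′ x q
    ... | yes refl with c Bool.≟ c′ | kind | kind′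
    ...   | yes refl | _ | _ =
      let x , p = half-nonempty (split (lookup v k)) c in x , below x p , below′ x p
    ...   | no c≢c′ | inj₁ (x , p , q) | _ =
      x , p , below′ x (trans (≢-not (q ∘ sym)) (sym (≢-not c≢c′)))
    ...   | no c≢c′ | inj₂ _ | inj₁ (x , p , q) =
      x , below x (trans (≢-not (q ∘ sym)) (sym (≢-not (c≢c′ ∘ sym)))) , p
    ...   | no _ | inj₂ (p , _) | inj₂ (q , _) = contradiction (trans (sym p) q) i≢j

    corner-consistent : ∀ β → Consistent λ j → bit (position j) β
    corner-consistent β {i} {j} i≢j =
      anchors-meet i≢j (anchored β (position i)) (anchored β (position j))

    corner : Vec Bool d → Vertex
    corner β = vertex _ (corner-consistent β)

    sign-corner : ∀ β j → sign (corner β) j ≡ bit (position j) β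
    sign-corner β = sign-vertex _ (corner-consistent β)

    sign-corner-member : ∀ β k → sign (corner β) (lookup v k) ≡ lookup β k
    sign-corner-member β k = trans (sign-corner β (lookup v k)) (bit-member (position (lookup v k)))
      where
      bit-member : (p : Position (lookup v k)) → bit p β ≡ lookup β k
      bit-member (member l eq)            = cong (lookup β) (lookup-clique-injective inc eq)
      bit-member (external ∉v _ _ _ _ _) = contradiction refl (∉v k)

    -- The signs at the members of `v` are the bits of `β`, so `corner` is injective; the other
    -- signs do not depend on `β`, so changing bit `k` switches `lookup v k` alone.
    hypercube : Buneman 𝒮 Contains Hypercube d
    hypercube = record { to = corner ; cong = λ { refl _ → refl } ; injective = injective } , adjacent _ _
      where
      injective : ∀ {β γ} → corner β ≈ corner γ → β ≡ γ
      injective {β} {γ} eq = begin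
        β                    ≡⟨ tabulate∘lookup β ⟨
        tabulate (lookup β)  ≡⟨ tabulate-cong (λ k → trans (sym (sign-corner-member β k))
          (trans (φ≡⇒sign≡ (corner β) (corner γ) (eq (lookup v k))) (sign-corner-member γ k))) ⟩
        tabulate (lookup γ)  ≡⟨ tabulate∘lookup γ ⟩
        γ                    ∎
        where open ≡-Reasoning
      adjacent : ∀ β γ → Graph._~_ (Hypercube d) β γ → corner β ~ corner γ
      adjacent β γ (k , ne , unique) = differsAt⇒~ (corner β) (corner γ) {lookup v k}
        ( (λ eq → ne (trans (sym (sign-corner-member β k)) (trans eq (sign-corner-member γ k))))
        , λ j vk≢j → trans (sign-corner β j) (trans (same vk≢j (position j)) (sym (sign-corner γ j))))
        where
        same : ∀ {j} → lookup v k ≢ j → (p : Position j) → bit p β ≡ bit p γ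
        same vk≢j (member l refl) = decidable-stable (lookup β l Bool.≟ lookup γ l)
          λ ne′ → vk≢j (cong (lookup v) (unique ne′))
        same _ (external _ _ _ _ _ _) = refl

  maximal⇒isDimension : ∀ {d} → Clique sides d → ¬ Clique sides (suc d) → IsDimension 𝒮 d
  maximal⇒isDimension (v , inc) maximal = Cube.hypercube inc maximal , λ e cube →
    ℕ.≮⇒≥ λ d<e → maximal (Clique-≤ d<e (contains⇒clique cube))

  -- A largest clique spans a hypercube of its own size `e`, whence `e ≤ d`.
  isDimension⇒¬clique : ∀ {d} → IsDimension 𝒮 d → ¬ Clique sides (suc d)
  isDimension⇒¬clique (_ , max) cl =
    let e , (v , inc) , maximal = maxClique sides
    in maximal (Clique-≤ (s≤s (max e (Cube.hypercube inc maximal))) cl)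

-- Lower bounds on four and six points

Pattern : ℕ → Set
Pattern m = Vec Bool m

is : Bool → Bool → Bool
is false b = not b
is true  b = b

is⇒≡ : ∀ c {b} → T (is c b) → b ≡ c
is⇒≡ false {false} _ = refl
is⇒≡ true  {true}  _ = refl

meet : ∀ {m} → Bool → Bool → Pattern m → Pattern m → Bool
meet c d []      []      = false
meet c d (x ∷ s) (y ∷ t) = is c x ∧ is d y ∨ meet c d s t

meet-sound : ∀ {m} c d (s t : Pattern m) → T (meet c d s t) →
  ∃ λ x → lookup s x ≡ c × lookup t x ≡ d
meet-sound c d []      []      ()
meet-sound c d (x ∷ s) (y ∷ t) h with Equivalence.to (Bool.T-∨ {is c x ∧ is d y}) h
... | inj₁ p = let q , r = Equivalence.to Bool.T-∧ p in zero , is⇒≡ c q , is⇒≡ d r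
... | inj₂ p = let x′ , q , r = meet-sound c d s t p in suc x′ , q , r

incompatible : ∀ {m} → Pattern m → Pattern m → Bool
incompatible s t =
  meet false true s t ∧ meet true false s t ∧ meet true true s t ∧ meet false false s t

incompatible-sound : ∀ {m} (s t : Pattern m) → T (incompatible s t) →
  Incompatible (lookup s) (lookup t)
incompatible-sound s t h c d
  with p , h′ ← Equivalence.to (Bool.T-∧ {meet false true s t}) h
  with q , h″ ← Equivalence.to (Bool.T-∧ {meet true false s t}) h′
  with r , u ← Equivalence.to (Bool.T-∧ {meet true true s t}) h″
  with c | d
... | false | true  = meet-sound false true s t p
... | true  | false = meet-sound true false s t q
... | true  | true  = meet-sound true true s t r
... | false | false = meet-sound false false s t u

hasClique : ∀ {m} → ℕ → List (Pattern m) → Bool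
hasClique zero    _       = true
hasClique (suc k) []      = false
hasClique (suc k) (s ∷ P) = hasClique k (filterᵇ (incompatible s) P) ∨ hasClique (suc k) P

hasClique-sound : ∀ {m} k (P : List (Pattern m)) → T (hasClique k P) →
  ∃ λ (v : Vec (Pattern m) k) →
    AllPairs (λ s t → Incompatible (lookup s) (lookup t)) v × All (_∈ᴸ P) v
hasClique-sound zero    P       _ = [] , [] , []
hasClique-sound (suc k) (s ∷ P) h =
  [ (λ p → let v , inc , v⊆ = hasClique-sound k _ p in
      s ∷ v ,
      All.map (λ {t} → incompatible-sound s t ∘ proj₂ ∘ ∈-filter⁻ _ {xs = P}) v⊆ ∷ inc ,
      List∃.here refl ∷ All.map (List∃.there ∘ proj₁ ∘ ∈-filter⁻ (T? ∘ incompatible s)) v⊆)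
  , (λ p → let v , inc , v⊆ = hasClique-sound (suc k) P p in
      v , inc , All.map List∃.there v⊆)
  ]′ (Equivalence.to (Bool.T-∨ {hasClique k (filterᵇ (incompatible s) P)}) h)

-- ((a , b) , (x , y)) demands a split separating a from b and x from y.
Clause : ℕ → Set
Clause m = (Fin m × Fin m) × (Fin m × Fin m)

separates : ∀ {m} → Pattern m → Fin m × Fin m → Bool
separates s (x , y) = lookup s x xor lookup s y

satisfies : ∀ {m} → Clause m → Pattern m → Bool
satisfies (p , q) s = separates s p ∧ separates s q

Sat : ∀ {s m} → Sides s m → Clause m → Set
Sat a ((x , y) , (z , w)) = ∃ λ i → a i x ≢ a i y × a i z ≢ a i w

patterns : ∀ m → List (Pattern m)
patterns zero    = [] ∷ []
patterns (suc m) = List.map (false ∷_) (patterns m) ++ List.map (true ∷_) (patterns m)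

∈-patterns : ∀ {m} (s : Pattern m) → s ∈ᴸ patterns m
∈-patterns []          = List∃.here refl
∈-patterns (false ∷ s) = ∈-++⁺ˡ (∈-map⁺ _ (∈-patterns s))
∈-patterns (true ∷ s)  = ∈-++⁺ʳ _ (∈-map⁺ _ (∈-patterns s))

-- A split is represented by its part avoiding zero.
normalised : ∀ m → List (Pattern (suc m))
normalised m = List.map (false ∷_) (patterns m)

-- P collects patterns known to be present: each unsatisfied clause is satisfied
-- by some pattern of S, which either completes suc k pairwise incompatible ones
-- or joins P.
refute : ∀ {m} → ℕ → List (Pattern m) → List (Clause m) → List (Pattern m) → Bool
refute k S []       P = false
refute k S (c ∷ cs) P with any (satisfies c) P
... | true  = refute k S cs P
... | false = all (λ s → hasClique k (filterᵇ (incompatible s) P) ∨ refute k S cs (s ∷ P))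
  (filterᵇ (satisfies c) S)

module _ {s m} (a : Sides s (suc m)) where

  private
    -- The `xor` with `a i zero` exchanges the two parts when `zero` lies in the stored one, which
    -- changes neither incompatibility nor separation.
    patternOf : Fin s → Pattern (suc m)
    patternOf i = false ∷ tabulate (λ x → a i zero xor a i (suc x))

    lookup-patternOf : ∀ i x → lookup (patternOf i) x ≡ a i zero xor a i x
    lookup-patternOf i zero = sym (Bool.xor-same (a i zero))
    lookup-patternOf i (suc x) = lookup∘tabulate (λ x → a i zero xor a i (suc x)) x

    Present : Pattern (suc m) → Set
    Present t = ∃ λ i → patternOf i ≡ t

    xor-cancel : ∀ b c d → b xor c ≡ b xor d → c ≡ d
    xor-cancel false _ _ eq = eq
    xor-cancel true _ _ eq = Bool.not-injective eq

    incompatible-patternOf : ∀ {i j} → Incompatible (lookup (patternOf i)) (lookup (patternOf j)) →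
      Incompatible (a i) (a j)
    incompatible-patternOf {i} {j} inc c d
      with x , p , q ← inc (a i zero xor c) (a j zero xor d) =
      x , xor-cancel (a i zero) _ _ (trans (sym (lookup-patternOf i x)) p)
        , xor-cancel (a j zero) _ _ (trans (sym (lookup-patternOf j x)) q)

    lift : ∀ {k} {v : Vec _ k} →
      AllPairs (λ s t → Incompatible (lookup s) (lookup t)) v →
      (ps : All Present v) → AllIncompatible a (All.reduce proj₁ ps)
    lift []          []                  = []
    lift (inc ∷ rest) ((i , refl) ∷ ps) = go inc ps ∷ lift rest ps
      where
      go : ∀ {k} {v : Vec _ k} → All (λ t → Incompatible (lookup (patternOf i)) (lookup t)) v →
        (ps : All Present v) → All (λ j → Incompatible (a i) (a j)) (All.reduce proj₁ ps)
      go []        []                 = []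
      go (p ∷ inc) ((j , refl) ∷ ps) = incompatible-patternOf p ∷ go inc ps

    separates-patternOf : ∀ i x y → a i x ≢ a i y → T (separates (patternOf i) (x , y))
    separates-patternOf i x y ne
      rewrite lookup-patternOf i x | lookup-patternOf i y = ≢⇒T (a i zero) _ _ ne
      where
      ≢⇒T : ∀ b c d → c ≢ d → T ((b xor c) xor (b xor d))
      ≢⇒T b     false false ne = contradiction refl ne
      ≢⇒T b     true  true  ne = contradiction refl ne
      ≢⇒T false false true  _  = _
      ≢⇒T true  false true  _  = _
      ≢⇒T false true  false _  = _
      ≢⇒T true  true  false _  = _

  -- Follows the branch of the search that `a` itself dictates: the split `i` satisfying the clause
  -- has its pattern `t` among the candidates, and `t` either completes a clique with present
  -- patterns or becomes present. The search fails once the clauses run out, so a successful one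
  -- must meet a clique.
  refute-sound : ∀ k cs P → T (refute k (normalised m) cs P) → List∀.All (Sat a) cs → List∀.All Present P →
    Clique a (suc k)
  refute-sound k (c@((x , y) , (z , w)) ∷ cs) P h ((i , p , q) List∀.∷ sat) present
    with any (satisfies c) P
  ... | true  = refute-sound k cs P h sat present
  ... | false = conclude (Equivalence.to (Bool.T-∨ {hasClique k (filterᵇ (incompatible t) P)})
    (List∀.lookup (List∀.all⁺ branch _ h)
      (∈-filter⁺ (T? ∘ satisfies c) (∈-map⁺ (false ∷_) (∈-patterns _))
        (Equivalence.from Bool.T-∧ (separates-patternOf i x y p , separates-patternOf i z w q)))))
    where
    t = patternOf i
    branch : Pattern _ → Bool
    branch s = hasClique k (filterᵇ (incompatible s) P) ∨ refute k (normalised m) cs (s ∷ P)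
    conclude : _ → _
    conclude (inj₂ h) = refute-sound k cs (t ∷ P) h sat ((i , refl) List∀.∷ present)
    conclude (inj₁ h) = let v , inc , v⊆ = hasClique-sound k _ h in _ ,
      lift (All.map (λ {s} → incompatible-sound t s ∘ proj₂ ∘ ∈-filter⁻ (T? ∘ incompatible t) {xs = P}) v⊆ ∷ inc)
        ((i , refl) ∷ All.map (List∀.lookup present ∘ proj₁ ∘ ∈-filter⁻ (T? ∘ incompatible t)) v⊆)

-- The demands of separation

sublists : ∀ {A : Set} → ℕ → List A → List (List A)
sublists zero    _        = [] ∷ []
sublists (suc k) []       = []
sublists (suc k) (x ∷ xs) = sublists (suc k) xs ++ List.map (x ∷_) (sublists k xs)

-- A clause is symmetric in its two pairs and within each pair, so four points give one clause for
-- each of the three ways to pair them.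
pairings : ∀ {m} → List (Fin m) → List (Clause m)
pairings (a ∷ b ∷ c ∷ d ∷ []) =
  ((a , b) , (c , d)) ∷ ((a , c) , (b , d)) ∷ ((a , d) , (b , c)) ∷ []
pairings _ = []

clauses : ∀ m → List (Clause m)
clauses m = concatMap pairings (sublists 4 (allFin m))

Proper : ∀ {m} → Clause m → Set
Proper ((a , b) , (x , y)) = Distinct x a b × Distinct y a b × x ≢ y

proper? : ∀ {m} (c : Clause m) → Dec (Proper c)
proper? ((a , b) , (x , y)) = distinct? x a b ×-dec distinct? y a b ×-dec ¬? (x Fin.≟ y)

-- One vote decides a majority only when the other two cancel.
maj-cancel : ∀ p q b c → maj p b c ≢ maj q b c → b ≢ c × p ≢ q
maj-cancel false false _     _     ne = contradiction refl ne
maj-cancel true  true  _     _     ne = contradiction refl ne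
maj-cancel false true  false false ne = contradiction refl ne
maj-cancel false true  true  true  ne = contradiction refl ne
maj-cancel true  false false false ne = contradiction refl ne
maj-cancel true  false true  true  ne = contradiction refl ne
maj-cancel false true  false true  _  = (λ ()) , (λ ())
maj-cancel false true  true  false _  = (λ ()) , (λ ())
maj-cancel true  false false true  _  = (λ ()) , (λ ())
maj-cancel true  false true  false _  = (λ ()) , (λ ())

-- The triples `x a b` and `y a b` share two points, so a split telling them apart divides `a` from
-- `b` and `x` from `y`.
Separating⇒Sat : ∀ {s m} {a : Sides s m} → Separating a → ∀ c → Proper c → Sat a c
Separating⇒Sat sep ((a , b) , (x , y)) (xab , yab , x≢y) =
  let i , ne = sep x a b y a b xab yab (x≢y , proj₁ xab , proj₁ (proj₂ xab)) in
  i , maj-cancel _ _ _ _ ne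

Refuted : ℕ → ℕ → Set
Refuted m k = refute k (normalised m) (clauses (suc m)) [] ≡ true

-- Restriction to the first `suc m` points keeps separation, and incompatibility of the restrictions
-- is witnessed by the same points in the whole set.
refuted⇒clique : ∀ m k → Refuted m k → List∀.All Proper (clauses (suc m)) →
  ∀ {s n} (a : Sides s n) → suc m ≤ n → Separating a → Clique a (suc k)
refuted⇒clique m k ref proper a m≤n sep = Clique-map (Incompatible-∘ ι)
  (refute-sound a′ k (clauses (suc m)) [] (Equivalence.from Bool.T-≡ ref)
    (List∀.map (λ {c} → Separating⇒Sat {a = a′} sep′ c) proper) List∀.[])
  where
  ι = λ x → inject≤ x m≤n
  a′ = λ i → a i ∘ ι
  sep′ : Separating a′
  sep′ = Separating-∘ {a = a} (Fin.inject≤-injective m≤n m≤n _ _) sep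

clique₂ : ∀ {s n} (a : Sides s n) → 4 ≤ n → Separating a → Clique a 2
clique₂ = refuted⇒clique 3 1 refl (toWitness {a? = List∀.all? proper? (clauses 4)} _)

-- Settled by evaluation: 45 clauses from the 15 quadruples of six points, against 32 normalised
-- patterns.
refuted₆ : Refuted 5 2
refuted₆ = refl

clique₃ : ∀ {s n} (a : Sides s n) → 6 ≤ n → Separating a → Clique a 3
clique₃ = refuted⇒clique 5 2 refuted₆ (toWitness {a? = List∀.all? proper? (clauses 6)} _)

-- The circular split system

OneOf : ∀ {n} → Fin n → Fin n → Fin n → Fin n → Set
OneOf w x y z = w ≡ x ⊎ w ≡ y ⊎ w ≡ z

-- A permutation of a triple, recorded through its effects on membership and majorities.
record Rearranges {n} (p q r x y z : Fin n) : Set where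
  field
    oneOf  : ∀ {w} → OneOf w p q r → OneOf w x y z
    oneOf⁻ : ∀ {w} → OneOf w x y z → OneOf w p q r
    majority≡ : ∀ a → majority a p q r ≡ majority a x y z

open Rearranges

module _ {n : ℕ} where

  unchanged : {x y z : Fin n} → Rearranges x y z x y z
  unchanged = record { oneOf = id ; oneOf⁻ = id ; majority≡ = λ _ → refl }

  _⨟_ : {x y z p q r u v w : Fin n} →
    Rearranges u v w p q r → Rearranges p q r x y z → Rearranges u v w x y z
  f ⨟ g = record
    { oneOf = oneOf g ∘ oneOf f ; oneOf⁻ = oneOf⁻ f ∘ oneOf⁻ g
    ; majority≡ = λ a → trans (majority≡ f a) (majority≡ g a) }

  swap₁₂ : {x y z : Fin n} → Rearranges y x z x y z
  swap₁₂ = record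
    { oneOf = swap ; oneOf⁻ = swap ; majority≡ = λ a → maj-comm₁₂ (a _) (a _) (a _) }
    where
    swap : ∀ {w x y z : Fin n} → OneOf w x y z → OneOf w y x z
    swap = [ inj₂ ∘ inj₁ , [ inj₁ , inj₂ ∘ inj₂ ]′ ]′

  swap₂₃ : {x y z : Fin n} → Rearranges x z y x y z
  swap₂₃ = record
    { oneOf = swap ; oneOf⁻ = swap ; majority≡ = λ a → maj-comm₂₃ (a _) (a _) (a _) }
    where
    swap : ∀ {w x y z : Fin n} → OneOf w x y z → OneOf w x z y
    swap = [ inj₁ , [ inj₂ ∘ inj₂ , inj₂ ∘ inj₁ ]′ ]′

sort : ∀ {n} {x y z : Fin n} → Distinct x y z →
  ∃ λ p → ∃ λ q → ∃ λ r → p F.< q × q F.< r × Rearranges p q r x y z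
sort {x = x} {y} {z} (x≢y , x≢z , y≢z) with Fin.<-cmp x y | Fin.<-cmp x z | Fin.<-cmp y z
... | tri≈ _ x≡y _ | _            | _            = contradiction x≡y x≢y
... | _            | tri≈ _ x≡z _ | _            = contradiction x≡z x≢z
... | _            | _            | tri≈ _ y≡z _ = contradiction y≡z y≢z
... | tri< x<y _ _ | _            | tri< y<z _ _ = _ , _ , _ , x<y , y<z , unchanged
... | tri< x<y _ _ | tri< x<z _ _ | tri> _ _ z<y = _ , _ , _ , x<z , z<y , swap₂₃
... | tri< x<y _ _ | tri> _ _ z<x | _            = _ , _ , _ , z<x , x<y , swap₁₂ ⨟ swap₂₃
... | tri> _ _ y<x | tri< x<z _ _ | _            = _ , _ , _ , y<x , x<z , swap₁₂
... | tri> _ _ y<x | tri> _ _ z<x | tri< y<z _ _ = _ , _ , _ , y<z , z<x , swap₂₃ ⨟ swap₁₂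
... | tri> _ _ y<x | _            | tri> _ _ z<y = _ , _ , _ , z<y , y<x ,
  swap₁₂ ⨟ (swap₂₃ ⨟ swap₁₂)

-- Increasing triples are equal as sets only if equal entry by entry. Each order hypothesis follows
-- directly the points that it concerns, so that a check by evaluation discards unsorted triples
-- early.
SortedSeparating : ∀ {s n} → Sides s n → Set
SortedSeparating {n = n} a = ∀ (x y : Fin n) → x F.< y → ∀ z → y F.< z →
  ∀ x′ y′ → x′ F.< y′ → ∀ z′ → y′ F.< z′ → ¬ (x ≡ x′ × y ≡ y′ × z ≡ z′) →
  ∃ λ i → majority (a i) x y z ≢ majority (a i) x′ y′ z′

sortedSeparating⇒separating : ∀ {s n} {a : Sides s n} → SortedSeparating a → Separating a
sortedSeparating⇒separating {a = a} sep x y z x′ y′ z′ xyz xyz′ (x≢x′ , x≢y′ , x≢z′) =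
  let p , q , r , p<q , q<r , re = sort xyz
      p′ , q′ , r′ , p′<q′ , q′<r′ , re′ = sort xyz′
      i , ne = sep p q p<q r q<r p′ q′ p′<q′ r′ q′<r′ λ (p≡ , q≡ , r≡) →
        [ x≢x′ , [ x≢y′ , x≢z′ ]′ ]′ (oneOf re′
          ([ (λ e → inj₁ (trans e p≡)) , [ (λ e → inj₂ (inj₁ (trans e q≡))) , (λ e → inj₂ (inj₂ (trans e r≡))) ]′ ]′
            (oneOf⁻ re (inj₁ refl))))
  in i , subst₂ _≢_ (majority≡ re (a i)) (majority≡ re′ (a i)) ne

lookup-injective : ∀ {A : Set} {xs : List A} → Unique xs →
  ∀ {i j} → List.lookup xs i ≡ List.lookup xs j → i ≡ j
lookup-injective (x∉ ∷ u) {zero}  {zero}  _  = refl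
lookup-injective (x∉ ∷ u) {zero}  {suc j} eq = contradiction eq (List∀.lookup x∉ (∈-lookup j))
lookup-injective (x∉ ∷ u) {suc i} {zero}  eq = contradiction (sym eq) (List∀.lookup x∉ (∈-lookup i))
lookup-injective (x∉ ∷ u) {suc i} {suc j} eq = cong suc (lookup-injective u eq)

does⇒ : ∀ {P : Set} (P? : Dec P) → does P? ≡ true → P
does⇒ (yes p) _ = p

does⇒¬ : ∀ {P : Set} (P? : Dec P) → does P? ≡ false → ¬ P
does⇒¬ (no ¬p) _ = ¬p

opaque

  interval : ℕ → ℕ → ∀ {n} → Fin n → Bool
  interval g h x = does ((g ≤? toℕ x) ×-dec (toℕ x <? h))

  interval-true⁺ : ∀ {n g h} {x : Fin n} → g ≤ toℕ x → toℕ x < h → interval g h x ≡ true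
  interval-true⁺ {g = g} {h} {x} g≤x x<h = dec-true ((g ≤? toℕ x) ×-dec (toℕ x <? h)) (g≤x , x<h)

  interval-true⁻ : ∀ {n g h} {x : Fin n} → interval g h x ≡ true → g ≤ toℕ x × toℕ x < h
  interval-true⁻ {g = g} {h} {x} = does⇒ ((g ≤? toℕ x) ×-dec (toℕ x <? h))

  below-interval : ∀ {n g h} {x : Fin n} → toℕ x < g → interval g h x ≡ false
  below-interval {g = g} {h} {x} x<g =
    dec-false ((g ≤? toℕ x) ×-dec (toℕ x <? h)) λ (g≤x , _) → ℕ.<⇒≱ x<g g≤x

  above-interval : ∀ {n g h} {x : Fin n} → h ≤ toℕ x → interval g h x ≡ false
  above-interval {g = g} {h} {x} h≤x =
    dec-false ((g ≤? toℕ x) ×-dec (toℕ x <? h)) λ (_ , x<h) → ℕ.<⇒≱ x<h h≤x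

  interval-false⁻ : ∀ {n g h} {x : Fin n} → interval g h x ≡ false → toℕ x < g ⊎ h ≤ toℕ x
  interval-false⁻ {g = g} {h} {x} eq with ℕ.<-≤-connex (toℕ x) g
  ... | inj₁ x<g = inj₁ x<g
  ... | inj₂ g≤x = inj₂ (ℕ.≮⇒≥ λ x<h →
    does⇒¬ ((g ≤? toℕ x) ×-dec (toℕ x <? h)) eq (g≤x , x<h))

-- A split that is circular for the order 0, …, n - 1 has one part that is an
-- interval avoiding n - 1.
arc : ∀ {n} {g h : Fin n} → g F.< h → Split n
arc {n} {g} {h} g<h = record
  { A          = tabulate inside
  ; A-nonempty = g , lookup⇒[]= g _ (trans (lookup∘tabulate inside g) (interval-true⁺ ℕ.≤-refl g<h))
  ; B-nonempty = h , lookup⇒[]= h _ (trans (lookup-map h not (tabulate inside))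
      (cong not (trans (lookup∘tabulate inside h) (above-interval ℕ.≤-refl))))
  }
  where
  inside : Fin n → Bool
  inside = interval (toℕ g) (toℕ h)

side-arc : ∀ {n} {g h : Fin n} (g<h : g F.< h) → side (arc g<h) ≗ interval (toℕ g) (toℕ h)
side-arc g<h = lookup∘tabulate _

-- The ends can be read off: each left end lies in the other interval, and once the left ends agree,
-- each right end lies outside the other interval and therefore not before its right end.
intervals-distinct : ∀ {n} {g h g′ h′ : Fin n} → g F.< h → g′ F.< h′ →
  (∀ x → interval (toℕ g) (toℕ h) x ≡ interval (toℕ g′) (toℕ h′) {n} x) → (g , h) ≡ (g′ , h′)
intervals-distinct {n} {g} {h} {g′} {h′} g<h g′<h′ eq = cong₂ _,_ g≡g′ h≡h′
  where
  starts : ∀ {g h g′ h′ : Fin n} → g F.< h →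
    (∀ x → interval (toℕ g) (toℕ h) x ≡ interval (toℕ g′) (toℕ h′) {n} x) → toℕ g′ ≤ toℕ g
  starts {g} g<h eq = proj₁ (interval-true⁻ (trans (sym (eq g)) (interval-true⁺ ℕ.≤-refl g<h)))
  g≡g′ : g ≡ g′
  g≡g′ = Fin.toℕ-injective (ℕ.≤-antisym (starts {h = h′} {h′ = h} g′<h′ (sym ∘ eq)) (starts {h = h} {h′ = h′} g<h eq))
  ends : ∀ {g h g′ h′ : Fin n} → g F.< h → g ≡ g′ →
    (∀ x → interval (toℕ g) (toℕ h) x ≡ interval (toℕ g′) (toℕ h′) {n} x) → toℕ h′ ≤ toℕ h
  ends {g} {h} {h′ = h′} g<h refl eq =
    [ (λ h<g → contradiction g<h (ℕ.<-asym h<g)) , id ]′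
      (interval-false⁻ {x = h} (trans (sym (eq h)) (above-interval {g = toℕ g} ℕ.≤-refl)))
  h≡h′ : h ≡ h′
  h≡h′ = Fin.toℕ-injective (ℕ.≤-antisym (ends {h = h′} {h′ = h} g′<h′ (sym g≡g′) (sym ∘ eq)) (ends {h = h} {h′ = h′} g<h g≡g′ eq))

-- Intervals with a common left or right end are nested, and intervals where one starts as the other
-- stops are disjoint; neither kind is incompatible.
intervals-crossing : ∀ {n} {g h g′ h′ : Fin n} →
  Incompatible {n} (interval (toℕ g) (toℕ h)) (interval (toℕ g′) (toℕ h′)) →
  g ≢ g′ × g ≢ h′ × h ≢ h′
intervals-crossing {n} {g} {h} {g′} {h′} inc =
    (λ { refl → ℕ.<-asym (ends inc) (ends (Incompatible-sym inc)) })
  , (λ { refl → let x , p , q = inc true true in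
      ℕ.<⇒≱ (proj₂ (interval-true⁻ {x = x} q)) (proj₁ (interval-true⁻ {x = x} p)) })
  , (λ { refl → ℕ.<-asym (starts inc) (starts (Incompatible-sym inc)) })
  where
  ends : ∀ {g h h′ : Fin n} →
    Incompatible {n} (interval (toℕ g) (toℕ h)) (interval (toℕ g) (toℕ h′)) → toℕ h′ < toℕ h
  ends {g} inc =
    let x , p , q = inc true false
        g≤x , x<h = interval-true⁻ {x = x} p
    in ℕ.≤-<-trans ([ (λ x<g → contradiction g≤x (ℕ.<⇒≱ x<g)) , id ]′ (interval-false⁻ {x = x} q)) x<h
  starts : ∀ {g g′ h : Fin n} →
    Incompatible {n} (interval (toℕ g) (toℕ h)) (interval (toℕ g′) (toℕ h)) → toℕ g < toℕ g′
  starts inc =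
    let x , p , q = inc true false
        g≤x , x<h = interval-true⁻ {x = x} p
    in ℕ.≤-<-trans g≤x ([ id , (λ h≤x → contradiction x<h (ℕ.≤⇒≯ h≤x)) ]′ (interval-false⁻ {x = x} q))

maj₁₂ : ∀ {a b c d} → a ≡ d → b ≡ d → maj a b c ≡ d
maj₁₂ {d = false} refl refl = refl
maj₁₂ {d = true}  refl refl = refl

maj₁₃ : ∀ {a b c d} → a ≡ d → c ≡ d → maj a b c ≡ d
maj₁₃ {a} {b} {c} p q = trans (maj-comm₂₃ a b c) (maj₁₂ {c = b} p q)

maj₂₃ : ∀ {a b c d} → b ≡ d → c ≡ d → maj a b c ≡ d
maj₂₃ {a} {b} {c} p q = trans (maj-comm₁₂ a b c) (maj₁₃ {b = a} p q)

-- With the points on a circle and gap `g` just before point `g`, a circular split is a chord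
-- joining two gaps; `complete` says that all of them are listed.
record Chords (n : ℕ) : Set where
  field
    size       : ℕ
    left right : Fin size → Fin n
    left<right : ∀ i → left i F.< right i
    unique     : ∀ {i j} → (left i , right i) ≡ (left j , right j) → i ≡ j
    complete   : ∀ {g h} → g F.< h → ∃ λ i → (g , h) ≡ (left i , right i)

chords : ∀ n → Chords n
chords n = record
  { left       = λ i → proj₁ (List.lookup pairs i)
  ; right      = λ i → proj₂ (List.lookup pairs i)
  ; left<right = λ i → proj₂ (∈-filter⁻ (uncurry F._<?_) {xs = grid} (∈-lookup i))
  ; unique     = lookup-injective (Unique.filter⁺ (uncurry F._<?_)
      (Unique.cartesianProduct⁺ (Unique.allFin⁺ n) (Unique.allFin⁺ n)))
  ; complete   = λ {g} {h} g<h →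
      let g,h∈ = ∈-filter⁺ (uncurry F._<?_) (∈-cartesianProduct⁺ (∈-allFin g) (∈-allFin h)) g<h
      in List∃.index g,h∈ , List∃.lookup-index g,h∈
  }
  where
  grid pairs : List (Fin n × Fin n)
  grid  = cartesianProduct (allFin n) (allFin n)
  pairs = filter (uncurry F._<?_) grid

module Circular {n} (C : Chords n) {last : Fin n}
  (0<last : 0 < toℕ last) (≤last : ∀ (x : Fin n) → toℕ x ≤ toℕ last) where

  open Chords C

  arcs : Fin size → Split n
  arcs i = arc (left<right i)

  arcs-sides : ∀ i → side (arcs i) ≗ interval (toℕ (left i)) (toℕ (right i))
  arcs-sides i = side-arc (left<right i)

  arc-index : ∀ g h → g < h → h < n → ∃ λ i → side (arcs i) ≗ interval g h
  arc-index g h g<h h<n =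
    let g<n = ℕ.<-trans g<h h<n
        i , eq = complete
          (subst₂ _<_ (sym (Fin.toℕ-fromℕ< g<n)) (sym (Fin.toℕ-fromℕ< h<n)) g<h)
    in i , λ x → trans (arcs-sides i x) (cong₂ (λ g h → interval g h x)
      (trans (cong (toℕ ∘ proj₁) (sym eq)) (Fin.toℕ-fromℕ< g<n))
      (trans (cong (toℕ ∘ proj₂) (sym eq)) (Fin.toℕ-fromℕ< h<n)))

  side-last : ∀ i → side (arcs i) last ≡ false
  side-last i = trans (arcs-sides i last) (above-interval (≤last (right i)))

  arcs-distinct : ∀ {i j} → arcs i ≋ arcs j → i ≡ j
  arcs-distinct {i} {j} (inj₁ eq) = unique
    (intervals-distinct (left<right i) (left<right j) λ x →
      trans (sym (arcs-sides i x)) (trans (cong (λ p → lookup p x) eq) (arcs-sides j x)))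
  -- Stored parts all avoid `last`, so no two are complementary.
  arcs-distinct {i} {j} (inj₂ eq) = contradiction
    (trans (sym (∈half⇒ (arcs i) true (subst (last ∈_) (sym eq) (⇒∈half (arcs j) (side-last j))))) (side-last i))
    λ ()

  -- Below `last`, the singleton of `x` is the interval from `x` to `suc x`; the singleton of `last`
  -- is the complement of the interval from 0 to `last`.
  arcs-trivial : ∀ x → ∃ λ i → ⁅ x ⁆ IsPartOf arcs i
  arcs-trivial x with toℕ x <? toℕ last
  ... | yes x<last =
    let i , eq = arc-index (toℕ x) (suc (toℕ x)) ℕ.≤-refl (ℕ.≤-<-trans x<last (Fin.toℕ<n last)) in
    i , inj₁ (⊆-antisym
      (λ y∈ → ⇒∈half (arcs i) {true} (subst (λ y → side (arcs i) y ≡ true) (sym (x∈⁅y⁆⇒x≡y _ y∈))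
        (trans (eq x) (interval-true⁺ {g = toℕ x} ℕ.≤-refl ℕ.≤-refl))))
      λ {y} y∈ → let x≤y , y≤x = interval-true⁻ {x = y} (trans (sym (eq y)) (∈half⇒ (arcs i) true y∈)) in
        subst (_∈ ⁅ x ⁆) (Fin.toℕ-injective (ℕ.≤-antisym x≤y (s≤s⁻¹ y≤x))) (x∈⁅x⁆ x))
  ... | no x≮last =
    let i , eq = arc-index 0 (toℕ last) 0<last (Fin.toℕ<n last)
        x≡last = ℕ.≤-antisym (≤last x) (ℕ.≮⇒≥ x≮last) in
    i , inj₂ (⊆-antisym
      (λ y∈ → ⇒∈half (arcs i) {false} (subst (λ y → side (arcs i) y ≡ false) (sym (x∈⁅y⁆⇒x≡y _ y∈))
        (trans (eq x) (above-interval {g = 0} (ℕ.≤-reflexive (sym x≡last))))))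
      λ {y} y∈ → [ (λ ()) , (λ last≤y → subst (_∈ ⁅ x ⁆)
        (Fin.toℕ-injective (trans x≡last (ℕ.≤-antisym last≤y (≤last y)))) (x∈⁅x⁆ x)) ]′
        (interval-false⁻ {g = 0} {x = y} (trans (sym (eq y)) (∈half⇒ (arcs i) false y∈))))

  circular : SplitSystem n
  circular = record
    { size = size ; split = arcs ; distinct = arcs-distinct ; trivial = arcs-trivial }

  Splits : (x y z x′ y′ z′ : Fin n) → Set
  Splits x y z x′ y′ z′ = ∃ λ i → majority (side (arcs i)) x y z ≢ majority (side (arcs i)) x′ y′ z′

  splits-sym : ∀ x y z x′ y′ z′ → Splits x y z x′ y′ z′ → Splits x′ y′ z′ x y z
  splits-sym _ _ _ _ _ _ (i , ne) = i , ne ∘ sym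

  splits : ∀ g h → g < h → h < n → ∀ {x y z x′ y′ z′ b} →
    majority (interval g h) x y z ≡ b → majority (interval g h) x′ y′ z′ ≡ not b →
    Splits x y z x′ y′ z′
  splits g h g<h h<n {x} {y} {z} {x′} {y′} {z′} p q =
    let i , eq = arc-index g h g<h h<n in
    i , λ same → Bool.not-¬ refl (trans (sym (trans (majority-cong eq x y z) p))
      (trans same (trans (majority-cong eq x′ y′ z′) q)))

  -- The cut just after `y` leaves `x` and `y` on one side, `y′` and `z′` on the other.
  middle-splits : ∀ (x y z x′ y′ z′ : Fin n) → x F.< y → y′ F.< z′ → y F.< y′ →
    Splits x y z x′ y′ z′
  middle-splits x y z x′ y′ z′ x<y y′<z′ y<y′ =
    splits 0 (suc (toℕ y)) (s≤s z≤n) (ℕ.≤-<-trans y<y′ (Fin.toℕ<n y′)) {x} {y} {z} {x′} {y′} {z′}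
      (maj₁₂ {c = interval 0 (suc (toℕ y)) z} (interval-true⁺ {g = 0} z≤n (ℕ.m<n⇒m<1+n x<y))
             (interval-true⁺ {g = 0} z≤n ℕ.≤-refl))
      (maj₂₃ {a = interval 0 (suc (toℕ y)) x′} (above-interval {g = 0} y<y′)
             (above-interval {g = 0} (ℕ.<-trans y<y′ y′<z′)))

  -- The interval from just after `x` up to and including `y` misses `x` and `z` but contains `x′`
  -- and `y`.
  first-splits : ∀ (x y z x′ z′ : Fin n) → y F.< z → x′ F.< y → x F.< x′ →
    Splits x y z x′ y z′
  first-splits x y z x′ z′ y<z x′<y x<x′ =
    splits g h (ℕ.≤-<-trans x<x′ (ℕ.m<n⇒m<1+n x′<y)) (ℕ.≤-<-trans y<z (Fin.toℕ<n z)) {x} {y} {z} {x′} {y} {z′}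
      (maj₁₃ {b = interval g h y} (below-interval {h = h} ℕ.≤-refl) (above-interval {g = g} y<z))
      (maj₁₂ {c = interval g h z′} (interval-true⁺ x<x′ (ℕ.m<n⇒m<1+n x′<y))
             (interval-true⁺ (ℕ.≤-trans x<x′ (ℕ.<⇒≤ x′<y)) ℕ.≤-refl))
    where
    g = suc (toℕ x)
    h = suc (toℕ y)

  -- The interval from `y` up to and including `z` contains `y` and `z` but misses `x′` and `z′`.
  last-splits : ∀ (x y z x′ z′ : Fin n) → x′ F.< y → y F.< z → z F.< z′ →
    Splits x y z x′ y z′
  last-splits x y z x′ z′ x′<y y<z z<z′ =
    splits g h (ℕ.m<n⇒m<1+n y<z) (ℕ.≤-<-trans z<z′ (Fin.toℕ<n z′)) {x} {y} {z} {x′} {y} {z′}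
      (maj₂₃ {a = interval g h x} (interval-true⁺ {g = g} ℕ.≤-refl (ℕ.m<n⇒m<1+n y<z))
             (interval-true⁺ {g = g} (ℕ.<⇒≤ y<z) ℕ.≤-refl))
      (maj₁₃ {b = interval g h y} (below-interval {h = h} x′<y) (above-interval {g = g} z<z′))
    where
    g = toℕ y
    h = suc (toℕ z)

  circular-sortedSeparating : SortedSeparating (λ i → side (arcs i))
  circular-sortedSeparating x y x<y z y<z x′ y′ x′<y′ z′ y′<z′ ne
    with Fin.<-cmp y y′ | Fin.<-cmp x x′ | Fin.<-cmp z z′
  ... | tri< y<y′ _ _ | _ | _ = middle-splits x y z x′ y′ z′ x<y y′<z′ y<y′
  ... | tri> _ _ y′<y | _ | _ =
    splits-sym x′ y′ z′ x y z (middle-splits x′ y′ z′ x y z x′<y′ y<z y′<y)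
  ... | tri≈ _ refl _ | tri< x<x′ _ _ | _ = first-splits x y z x′ z′ y<z x′<y′ x<x′
  ... | tri≈ _ refl _ | tri> _ _ x′<x | _ =
    splits-sym x′ y z′ x y z (first-splits x′ y z′ x z y′<z′ x<y x′<x)
  ... | tri≈ _ refl _ | tri≈ _ _ _ | tri< z<z′ _ _ = last-splits x y z x′ z′ x′<y′ y<z z<z′
  ... | tri≈ _ refl _ | tri≈ _ _ _ | tri> _ _ z′<z =
    splits-sym x′ y z′ x y z (last-splits x′ y z′ x z x<y y′<z′ z′<z)
  ... | tri≈ _ refl _ | tri≈ _ refl _ | tri≈ _ refl _ = contradiction (refl , refl , refl) ne

  circular-separating : Separating (λ i → side (arcs i))
  circular-separating = sortedSeparating⇒separating {a = λ i → side (arcs i)} circular-sortedSeparating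

  -- The `d` left ends and `d` right ends of the chords are pairwise distinct elements of `Fin n`.
  clique⇒2d≤n : ∀ {d} → Clique (λ i → side (arcs i)) d → d + d ≤ n
  clique⇒2d≤n {d} (v , inc) = Fin.injective⇒≤ {f = endpoint ∘ splitAt d} λ eq →
    splitAt-injective (endpoint-injective _ _ eq)
    where
    endpoint : Fin d ⊎ Fin d → Fin n
    endpoint (inj₁ k) = left (lookup v k)
    endpoint (inj₂ k) = right (lookup v k)

    crossing : ∀ {k l} → k ≢ l → left (lookup v k) ≢ left (lookup v l) ×
      left (lookup v k) ≢ right (lookup v l) × right (lookup v k) ≢ right (lookup v l)
    crossing {k} {l} k≢l = intervals-crossing (Incompatible-resp
      (arcs-sides (lookup v k)) (arcs-sides (lookup v l)) (lookup-incompatible inc k≢l))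

    left≢right : ∀ k l → left (lookup v k) ≢ right (lookup v l)
    left≢right k l with k Fin.≟ l
    ... | yes refl = λ eq → ℕ.<-irrefl (cong toℕ eq) (left<right (lookup v k))
    ... | no  k≢l  = proj₁ (proj₂ (crossing k≢l))

    endpoint-injective : ∀ p q → endpoint p ≡ endpoint q → p ≡ q
    endpoint-injective (inj₁ k) (inj₁ l) eq = cong inj₁ (decidable-stable (k Fin.≟ l)
      λ k≢l → proj₁ (crossing k≢l) eq)
    endpoint-injective (inj₂ k) (inj₂ l) eq = cong inj₂ (decidable-stable (k Fin.≟ l)
      λ k≢l → proj₂ (proj₂ (crossing k≢l)) eq)
    endpoint-injective (inj₁ k) (inj₂ l) eq = contradiction eq (left≢right k l)
    endpoint-injective (inj₂ k) (inj₁ l) eq = contradiction (sym eq) (left≢right l k)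

    splitAt-injective : ∀ {i j : Fin (d + d)} → splitAt d i ≡ splitAt d j → i ≡ j
    splitAt-injective {i} {j} eq =
      trans (sym (Fin.join-splitAt d d i)) (trans (cong (F.join d d) eq) (Fin.join-splitAt d d j))

  circular-¬clique : ¬ Clique (λ i → side (arcs i)) (suc ⌊ n /2⌋)
  circular-¬clique cl = ℕ.1+n≰n (ℕ.≤-trans
    (ℕ.≤-reflexive (ℕ.n≡⌊n+n/2⌋ (suc ⌊ n /2⌋))) (ℕ.⌊n/2⌋-mono (clique⇒2d≤n cl)))

-- A three-dimensional system on eight points

infix 4 _≟ˢ_

_≟ˢ_ : ∀ {n} (p q : Subset n) → Dec (p ≡ q)
_≟ˢ_ = Vec.≡-dec Bool._≟_

-- What `Split` and `SplitSystem` require of the stored parts, in a form that is decidable by finite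
-- checks.
Enumerates : ∀ {s n} → Vec (Subset n) s → Set
Enumerates v =
  (∀ i → Nonempty (lookup v i)) ×
  (∀ i → Nonempty (∁ (lookup v i))) ×
  (∀ i j → lookup v i ≡ lookup v j ⊎ lookup v i ≡ ∁ (lookup v j) → i ≡ j) ×
  (∀ x → ∃ λ i → ⁅ x ⁆ ≡ lookup v i ⊎ ⁅ x ⁆ ≡ ∁ (lookup v i))

enumerates? : ∀ {s n} → Decidable (Enumerates {s} {n})
enumerates? v =
  Fin.all? (λ i → nonempty? (lookup v i)) ×-dec
  Fin.all? (λ i → nonempty? (∁ (lookup v i))) ×-dec
  Fin.all? (λ i → Fin.all? λ j →
    ((lookup v i ≟ˢ lookup v j) ⊎-dec (lookup v i ≟ˢ ∁ (lookup v j))) →-dec (i Fin.≟ j)) ×-dec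
  Fin.all? (λ x → Fin.any? λ i → (⁅ x ⁆ ≟ˢ lookup v i) ⊎-dec (⁅ x ⁆ ≟ˢ ∁ (lookup v i)))

fromVec : ∀ {s n} (v : Vec (Subset n) s) → Enumerates v → SplitSystem n
fromVec v (A≢∅ , B≢∅ , distinct , trivial) = record
  { split    = λ i → record { A = lookup v i ; A-nonempty = A≢∅ i ; B-nonempty = B≢∅ i }
  ; distinct = distinct _ _
  ; trivial  = trivial
  }

pattern O = false
pattern I = true

-- The eight singletons and fifteen further parts; the checks below verify the required properties
-- by evaluation.
parts₈ : Vec (Subset 8) 23
parts₈ =
  (I ∷ O ∷ O ∷ O ∷ O ∷ O ∷ O ∷ O ∷ []) ∷
  (O ∷ I ∷ O ∷ O ∷ O ∷ O ∷ O ∷ O ∷ []) ∷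
  (O ∷ O ∷ I ∷ O ∷ O ∷ O ∷ O ∷ O ∷ []) ∷
  (O ∷ O ∷ O ∷ I ∷ O ∷ O ∷ O ∷ O ∷ []) ∷
  (O ∷ O ∷ O ∷ O ∷ I ∷ O ∷ O ∷ O ∷ []) ∷
  (O ∷ O ∷ O ∷ O ∷ O ∷ I ∷ O ∷ O ∷ []) ∷
  (O ∷ O ∷ O ∷ O ∷ O ∷ O ∷ I ∷ O ∷ []) ∷
  (O ∷ O ∷ O ∷ O ∷ O ∷ O ∷ O ∷ I ∷ []) ∷
  (I ∷ I ∷ O ∷ O ∷ O ∷ O ∷ O ∷ O ∷ []) ∷
  (I ∷ O ∷ I ∷ O ∷ O ∷ O ∷ O ∷ O ∷ []) ∷
  (O ∷ I ∷ I ∷ O ∷ O ∷ O ∷ O ∷ O ∷ []) ∷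
  (I ∷ O ∷ O ∷ I ∷ O ∷ O ∷ O ∷ O ∷ []) ∷
  (O ∷ I ∷ O ∷ I ∷ O ∷ O ∷ O ∷ O ∷ []) ∷
  (O ∷ O ∷ I ∷ I ∷ O ∷ O ∷ O ∷ O ∷ []) ∷
  (I ∷ O ∷ O ∷ I ∷ I ∷ O ∷ O ∷ O ∷ []) ∷
  (I ∷ I ∷ O ∷ O ∷ O ∷ I ∷ O ∷ O ∷ []) ∷
  (I ∷ I ∷ O ∷ O ∷ I ∷ I ∷ O ∷ O ∷ []) ∷
  (O ∷ I ∷ I ∷ O ∷ O ∷ O ∷ I ∷ O ∷ []) ∷
  (O ∷ O ∷ O ∷ O ∷ I ∷ O ∷ I ∷ O ∷ []) ∷
  (I ∷ O ∷ I ∷ O ∷ I ∷ O ∷ I ∷ O ∷ []) ∷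
  (I ∷ I ∷ I ∷ I ∷ I ∷ O ∷ I ∷ O ∷ []) ∷
  (O ∷ I ∷ I ∷ O ∷ O ∷ I ∷ I ∷ O ∷ []) ∷
  (I ∷ I ∷ O ∷ O ∷ I ∷ I ∷ I ∷ O ∷ []) ∷ []

system₈ : SplitSystem 8
system₈ = fromVec parts₈ (does⇒ (enumerates? parts₈) refl)

sides₈ : Sides 23 8
sides₈ i = lookup (lookup parts₈ i)

separating₈ : SortedSeparating sides₈
separating₈ = does⇒ (
  Fin.all? λ x → Fin.all? λ y → x F.<? y →-dec Fin.all? λ z → y F.<? z →-dec
  Fin.all? λ x′ → Fin.all? λ y′ → x′ F.<? y′ →-dec Fin.all? λ z′ → y′ F.<? z′ →-dec
  ¬? (x Fin.≟ x′ ×-dec y Fin.≟ y′ ×-dec z Fin.≟ z′) →-dec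
  Fin.any? λ i → ¬? (majority (sides₈ i) x y z Bool.≟ majority (sides₈ i) x′ y′ z′)) refl

¬clique₈ : ¬ Clique sides₈ 4
¬clique₈ (i ∷ j ∷ k ∷ l ∷ [] , (ij ∷ ik ∷ il ∷ []) ∷ (jk ∷ jl ∷ []) ∷ (kl ∷ []) ∷ [] ∷ []) =
  -- Nested implications let the evaluation drop a branch at the first pair that is not
  -- incompatible.
  does⇒ (
    Fin.all? λ i → Fin.all? λ j → i ∥? j →-dec
    Fin.all? λ k → i ∥? k →-dec j ∥? k →-dec
    Fin.all? λ l → i ∥? l →-dec j ∥? l →-dec ¬? (k ∥? l)) refl
    i j ij k ik jk l il jl kl
  where
  _∥?_ : ∀ i j → Dec (Incompatible (sides₈ i) (sides₈ j))
  i ∥? j = incompatible? (sides₈ i) (sides₈ j)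

-- Decidability of the existence of an injective system

module _ {n} (𝒮 : SplitSystem n) where
  open SplitSystem 𝒮
  open Signs 𝒮 using (sides)

  -- Distinct splits store distinct subsets, coded here as numbers below `2 ^ n`. This bounds the
  -- search in `feasible?`.
  size≤2^n : size ≤ 2 ^ n
  size≤2^n = Fin.injective⇒≤ {f = code} code-injective
    where
    open Inverse Fin.2↔Bool using (to; from; strictlyInverseˡ)
    code : Fin size → Fin (2 ^ n)
    code i = funToFin (from ∘ sides i)
    decode : ∀ i x → to (finToFun (code i) x) ≡ sides i x
    decode i x = trans (cong to (Fin.finToFun-funToFin (from ∘ sides i) x)) (strictlyInverseˡ (sides i x))
    code-injective : ∀ {i j} → code i ≡ code j → i ≡ j
    code-injective {i} {j} eq = distinct (inj₁ (begin
      Split.A (split i)    ≡⟨ tabulate∘lookup _ ⟨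
      tabulate (sides i)   ≡⟨ tabulate-cong (λ x →
        trans (sym (decode i x)) (trans (cong (λ c → to (finToFun c x)) eq) (decode j x))) ⟩
      tabulate (sides j)   ≡⟨ tabulate∘lookup _ ⟩
      Split.A (split j)    ∎))
      where open ≡-Reasoning

  toVec : Vec (Subset n) size
  toVec = tabulate (Split.A ∘ split)

  lookup-toVec : ∀ i → lookup toVec i ≡ Split.A (split i)
  lookup-toVec = lookup∘tabulate (Split.A ∘ split)

  toVec-enumerates : Enumerates toVec
  toVec-enumerates =
      (λ i → subst Nonempty (sym (lookup-toVec i)) (Split.A-nonempty (split i)))
    , (λ i → subst (Nonempty ∘ ∁) (sym (lookup-toVec i)) (Split.B-nonempty (split i)))
    , (λ i j → distinct ∘ subst₂ (λ p q → p ≡ q ⊎ p ≡ ∁ q) (lookup-toVec i) (lookup-toVec j))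
    , λ x → let i , p = trivial x in
        i , subst (λ q → ⁅ x ⁆ ≡ q ⊎ ⁅ x ⁆ ≡ ∁ q) (sym (lookup-toVec i)) p

Feasible : ℕ → ℕ → Set
Feasible n d = ∃ λ (𝒮 : SplitSystem n) → Separating (Signs.sides 𝒮) × ¬ Clique (Signs.sides 𝒮) (suc d)

-- A system is determined by the vector of its stored parts, whose length is at most `2 ^ n`; the
-- bound of `anyUpTo?` is strict, hence the `suc`.
feasible? : ∀ n → Decidable (Feasible n)
feasible? n d = map′
  (λ (s , _ , v , enum , sep , ¬cl) → fromVec v enum , sep , ¬cl)
  (λ (𝒮 , sep , ¬cl) → SplitSystem.size 𝒮 , s≤s (size≤2^n 𝒮) , toVec 𝒮 , toVec-enumerates 𝒮 ,
    Separating-resp (λ i x → cong (λ p → lookup p x) (sym (lookup-toVec 𝒮 i))) sep ,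
    ¬cl ∘ Clique-map (λ {i} {j} → Incompatible-resp
      (λ x → cong (λ p → lookup p x) (lookup-toVec 𝒮 i))
      (λ x → cong (λ p → lookup p x) (lookup-toVec 𝒮 j))))
  (ℕ.anyUpTo? (λ s → searchVec anySubset? s λ v →
    enumerates? v ×-dec separating? (sidesOf v) ×-dec ¬? (clique? (sidesOf v) (suc d))) (suc (2 ^ n)))
  where
  sidesOf : ∀ {s} → Vec (Subset n) s → Sides s n
  sidesOf v i = lookup (lookup v i)

least-feasible⇒injectiveDimension : ∀ {n d} → IsMinimum (Feasible n) d → IsInjectiveDimension n d
least-feasible⇒injectiveDimension {n} {d} ((𝒮 , sep , ¬cl) , least) =
  (𝒮 , Medians.separating⇒injective 𝒮 sep , 𝒮-dimension) ,
  λ e (𝒯 , inj , dim) →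
    least e (𝒯 , Medians.injective⇒separating 𝒯 inj , Dimension.isDimension⇒¬clique 𝒯 dim)
  where
  𝒮-dimension : IsDimension 𝒮 d
  -- The largest clique has size `e ≤ d`, and the system is feasible for `e` as well, so minimality
  -- of `d` gives `e ≡ d`.
  𝒮-dimension with e , cl , ¬cl′ ← maxClique (Signs.sides 𝒮) =
    subst (IsDimension 𝒮) (ℕ.≤-antisym (ℕ.≮⇒≥ λ d<e → ¬cl (Clique-≤ d<e cl)) (least e (𝒮 , sep , ¬cl′)))
      (Dimension.maximal⇒isDimension 𝒮 cl ¬cl′)

-- Bounds on the injective dimension

circular-feasible : ∀ m → Feasible (2 + m) ⌊ 2 + m /2⌋
circular-feasible m = circular , circular-separating , circular-¬clique
  where
  open Circular (chords (2 + m)) {last = fromℕ (suc m)} (s≤s z≤n)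
    (λ x → ℕ.≤-trans (Fin.toℕ≤pred[n] x) (ℕ.≤-reflexive (sym (Fin.toℕ-fromℕ (suc m)))))

feasible₈ : Feasible 8 3
feasible₈ = system₈ , sortedSeparating⇒separating {a = sides₈} separating₈ , ¬clique₈

feasible⇒≥ : ∀ {n d k} → (∀ (𝒮 : SplitSystem n) → Separating (Signs.sides 𝒮) → Clique (Signs.sides 𝒮) k) →
  Feasible n d → k ≤ d
feasible⇒≥ clique (𝒮 , sep , ¬cl) = ℕ.≮⇒≥ λ d<k → ¬cl (Clique-≤ d<k (clique 𝒮 sep))

-- Opaque, lest checking ID 3 ≡ 1 run the exhaustive search.
opaque
  minimum : ∀ m → ∃ (IsMinimum (Feasible (2 + m)))
  minimum m = least (feasible? (2 + m)) (circular-feasible m)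

theorem3 :
    ∃ λ (ID : ℕ → ℕ) →
      (∀ n → 3 ≤ n → IsInjectiveDimension n (ID n)) ×
      (∀ n → 4 ≤ n → ID n ≤ ⌊ n /2⌋) ×
      ID 3 ≡ 1 ×
      (ID 4 ≡ 2 × ID 5 ≡ 2) ×
      (ID 6 ≡ 3 × ID 7 ≡ 3 × ID 8 ≡ 3) ×
      (∀ n → 9 ≤ n → 3 ≤ ID n)
theorem3 = ID , dimension , (λ n 4≤n → upper n (ℕ.≤-trans (s≤s (s≤s z≤n)) 4≤n)) ,
  ℕ.≤-antisym (upper 3 (s≤s (s≤s z≤n))) (feasible⇒≥ clique₁ (proj₁ (proj₂ (minimum 1)))) ,
  ( ℕ.≤-antisym (upper 4 (s≤s (s≤s z≤n))) (lower₂ 2 ℕ.≤-refl)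
  , ℕ.≤-antisym (upper 5 (s≤s (s≤s z≤n))) (lower₂ 3 (ℕ.m≤n+m 4 1))) ,
  ( ℕ.≤-antisym (upper 6 (s≤s (s≤s z≤n))) (lower₃ 6 ℕ.≤-refl)
  , ℕ.≤-antisym (upper 7 (s≤s (s≤s z≤n))) (lower₃ 7 (ℕ.m≤n+m 6 1))
  -- The circular system would only give 4 here.
  , ℕ.≤-antisym (proj₂ (proj₂ (minimum 6)) 3 feasible₈) (lower₃ 8 (ℕ.m≤n+m 6 2))) ,
  λ n 9≤n → lower₃ n (ℕ.≤-trans (ℕ.m≤n+m 6 3) 9≤n)
  where
  ID : ℕ → ℕ
  ID (suc (suc m)) = proj₁ (minimum m)
  -- An arbitrary value at 0 and 1, outside the range of the theorem.
  ID _             = 0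

  dimension : ∀ n → 3 ≤ n → IsInjectiveDimension n (ID n)
  dimension (suc (suc m)) (s≤s (s≤s _)) = least-feasible⇒injectiveDimension (proj₂ (minimum m))

  upper : ∀ n → 2 ≤ n → ID n ≤ ⌊ n /2⌋
  upper (suc (suc m)) (s≤s (s≤s _)) = proj₂ (proj₂ (minimum m)) _ (circular-feasible m)

  -- Any single split is a clique, and a trivial split always exists.
  clique₁ : ∀ {n} (𝒮 : SplitSystem (suc n)) → Separating (Signs.sides 𝒮) → Clique (Signs.sides 𝒮) 1
  clique₁ 𝒮 _ = proj₁ (SplitSystem.trivial 𝒮 zero) ∷ [] , [] ∷ []

  lower₂ : ∀ m → 4 ≤ 2 + m → 2 ≤ proj₁ (minimum m)
  lower₂ m 4≤n = feasible⇒≥ (λ 𝒮 → clique₂ (Signs.sides 𝒮) 4≤n) (proj₁ (proj₂ (minimum m)))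

  lower₃ : ∀ n → 6 ≤ n → 3 ≤ ID n
  lower₃ (suc zero)    (s≤s ())
  lower₃ (suc (suc m)) 6≤n = feasible⇒≥ (λ 𝒮 → clique₃ (Signs.sides 𝒮) 6≤n) (proj₁ (proj₂ (minimum m)))
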